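{- Let $\mathcal{A}=\{\langle\lambda_s,a_s,n_s\rangle\}_{s=1}^k$ where $\lambda_s,a_s,n_s\in\mathbb{Z}$ and $0\leqslant a_s<n_s$ for each $s$. Let $S(n_1,\ldots,n_k)=\{r/n_s: r=0,\ldots,n_s-1;\ s=1,\ldots,k\}\subseteq\mathbb{Q}$, let $p>|S(n_1,\ldots,n_k)|$ be a prime, and let $\zeta_p$ be any primitive $p$th root of unity. Define $w_{\mathcal{A}}:\mathbb{Z}\to\mathbb{Z}$ by $$w_{\mathcal{A}}(x)=\sum_{\substack{1\leqslant s\leqslant k\\ x\equiv a_s \pmod{n_s}}}\lambda_s.$$ Then $w_{\mathcal{A}}(x)=0$ for all $x\in\mathbb{Z}$ if and only if $$\sum_{s=1}^k\lambda_s\frac{\zeta_p^{a_s}}{1-\zeta_p^{n_s}}=0.$$ -}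

module Defs where

open import Level using (Level; _⊔_) renaming (suc to lsuc)
open import Data.Nat as ℕ using (ℕ; zero; suc)
import Data.Nat.Divisibility as ℕDiv
open import Data.Integer as ℤ using (ℤ; +_; -[1+_]; ∣_∣)
open import Data.Fin using (Fin)
open import Data.List using (List; []; _∷_; map; filter; foldr; concatMap; length; upTo; allFin; deduplicate)
open import Data.Rational as ℚ using (ℚ)
open import Relation.Nullary using (¬_)
import Data.Product as P
open import Algebra.Bundles using (CommutativeRing; Semiring)
import Algebra.Definitions.RawSemiring as RawSemiringDefs

record CharZeroField (c ℓ : Level) : Set (lsuc (c ⊔ ℓ)) where
  field
    commutativeRing : CommutativeRing c ℓ
  open CommutativeRing commutativeRing public
  open RawSemiringDefs (Semiring.rawSemiring semiring) public using (_×_; _^_)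
  infix 8 _⁻¹
  field
    _⁻¹      : Carrier → Carrier
    ⁻¹-cong  : ∀ {x y} → x ≈ y → x ⁻¹ ≈ y ⁻¹
    inverseʳ : ∀ x → ¬ (x ≈ 0#) → x * x ⁻¹ ≈ 1#
    0≉1      : ¬ (0# ≈ 1#)
    charZero : ∀ m → ¬ (suc m × 1# ≈ 0#)

  _/_ : Carrier → Carrier → Carrier
  x / y = x * y ⁻¹

  fromℤ : ℤ → Carrier
  fromℤ (+ m)     = m × 1#
  fromℤ -[1+ m ]  = - (suc m × 1#)

  Σ-list : List Carrier → Carrier
  Σ-list = foldr _+_ 0#

  IsPrimitiveRoot : ℕ → Carrier → Set ℓ
  IsPrimitiveRoot p ζ =
    (ζ ^ p ≈ 1#) P.× (∀ j → 0 ℕ.< j → j ℕ.< p → ¬ (ζ ^ j ≈ 1#))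

  -- Σ_{s=1}^k λ_s ζ^{a_s} / (1 - ζ^{n_s})   (a_s, n_s ≥ 0 under the hypotheses;
  -- integer exponents are taken through their absolute value)
  cycloSum : (k : ℕ) → (lam a n : Fin k → ℤ) → Carrier → Carrier
  cycloSum k lam a n ζ =
    Σ-list (map (λ s → fromℤ (lam s) * ((ζ ^ ∣ a s ∣) / (1# - ζ ^ ∣ n s ∣))) (allFin k))

-- x ≡ a (mod n), i.e. n ∣ x - a (integer divisibility), decided via
-- absolute values as in Data.Integer.Divisibility.
w : (k : ℕ) → (lam a n : Fin k → ℤ) → ℤ → ℤ
w k lam a n x =
  foldr ℤ._+_ (+ 0)
    (map lam (filter (λ s → ∣ n s ∣ ℕDiv.∣? ∣ x ℤ.- a s ∣) (allFin k)))

fracs : ℕ → List ℚ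
fracs zero        = []
fracs d@(suc _)   = map (λ r → (+ r) ℚ./ d) (upTo d)

S : (k : ℕ) → (Fin k → ℤ) → List ℚ
S k n = deduplicate ℚ._≟_ (concatMap (λ s → fracs ∣ n s ∣) (allFin k))

cardS : (k : ℕ) → (Fin k → ℤ) → ℕ
cardS k n = length (S k n)

{-# OPTIONS --safe #-}

-- Let D be the least common multiple of the z^(n s) - 1 in ℤ[z]. It is monic, and its degree is the
-- number |S| of distinct fractions r / n s. Writing Σ λ_s z^(a s) / (1 - z^(n s)) = - P / D gives
-- P ∈ ℤ[z] with deg P < |S| ≤ p - 1, because a s < n s. As 1, ζ, …, ζ^(p-2) are linearly independent
-- over ℤ, vanishing of the sum at ζ forces P = 0. With N a common multiple of the n s, the same
-- fraction equals - W / (z^N - 1), where the coefficients of W are w 0, …, w (N - 1); so P = 0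
-- exactly if w vanishes on a period. Conversely w = 0 kills W, and ζ^N ≠ 1 since p ∤ N.
--
-- D exists over ℤ, not merely over ℚ: by induction lcm(A, B) = A B / gcd(A, B), where for A = zⁿ - 1
-- and B = lcm(z^m - 1) the gcd is lcm(z^gcd(n, m) - 1) and is an integral combination of A and B.
module Submission where

open import Algebra.Bundles using (CommutativeRing)
open import Algebra.Solver.Ring.AlmostCommutativeRing
  using (_-Raw-AlmostCommutative⟶_; fromCommutativeRing; -raw-almostCommutative⟶)
open import Data.Bool using (Bool; true; false; _∨_; _∧_; if_then_else_)
import Data.Bool.Properties as Boolₚ
open import Data.Empty using (⊥; ⊥-elim)
open import Data.Fin using (Fin; zero; suc)
open import Data.Integer as ℤ using (ℤ; +_; -[1+_]; ∣_∣; _◃_)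
import Data.Integer.DivMod as ℤDivMod
import Data.Integer.Divisibility.Signed as ℤDiv
import Data.Integer.Properties as ℤₚ
open import Data.Integer.Tactic.RingSolver using (solve-∀)
open import Data.List using (List; []; _∷_; map; filter; foldr; length; _++_; [_]; allFin)
open import Data.List.Membership.Propositional using (_∈_; lose)
open import Data.List.Membership.Propositional.Properties
  using (∈-∃++; ∈-++⁻; ∈-++⁺ˡ; ∈-++⁺ʳ; ∈-map⁺; ∈-upTo⁺; ∈-allFin; ∈-concatMap⁺; ∈-deduplicate⁺)
import Data.List.Properties as Listₚ
open import Data.List.Relation.Unary.Any using (here; there)
open import Data.Maybe using (Maybe; just; nothing)
open import Data.Nat as ℕ using (ℕ; zero; suc; _≤_; _<_; z≤n; s≤s; NonZero)
open import Data.Nat.Combinatorics using (_C_; nCk+nC[k+1]≡[n+1]C[k+1]; nC1≡n; nCn≡1; k>n⇒nCk≡0)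
open import Data.Nat.Divisibility as ℕDiv using (_∣_; _∣?_; divides; ∣-trans)
import Data.Nat.DivMod as ℕDivMod
open import Data.Nat.GCD as GCD using (gcd; gcd[m,n]∣m; gcd[m,n]∣n; gcd-greatest; gcd-GCD; module Bézout)
open import Data.Nat.Primality using (Prime; euclidsLemma; ¬prime[0]; ¬prime[1])
import Data.Nat.Properties as ℕₚ
open import Data.Nat.Tactic.RingSolver using () renaming (solve-∀ to ℕ-solve-∀)
open import Data.Product using (∃; _×_; _,_; proj₁; proj₂)
open import Data.Rational as ℚ using (ℚ)
import Data.Rational.Properties as ℚₚ
open import Data.Rational.Unnormalised using (mkℚᵘ; *≡*)
import Data.Sign as Sign
open import Data.Sum using (_⊎_; inj₁; inj₂; [_,_]′)
import Data.Vec.Functional as Vector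
open import Function using (_∘_; mk⇔)
open import Function.Bundles using (_⇔_)
open import Relation.Binary.Definitions using (tri<; tri≈; tri>)
open import Relation.Binary.PropositionalEquality as ≡
  using (_≡_; _≢_; refl; sym; trans; cong; cong₂; subst; module ≡-Reasoning)
open import Relation.Nullary using (¬_; Dec; yes; no; contradiction; does)
open import Relation.Nullary.Decidable using (does-⇔; dec-true; dec-false; _×-dec_)
open import Defs

-- Coprimality over ℤ does not yield a Bézout identity: z - 1 and z + 1 generate an ideal that
-- contains 2 but not 1. The induction for the lcm therefore has to carry an ideal membership over
-- ℤ, and it can because for polynomials zⁿ - 1 the Euclidean algorithm acts on the exponents alone.
-- The degree of the lcm follows by running deg lcm + deg gcd = deg A + deg B in parallel with
-- inclusion-exclusion for sets of fractions.
--
-- Integrality is needed later: the independence proof ends because a nonzero integer can be divided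
-- by p only finitely often. Equality in the field is not assumed decidable, so that proof does not
-- divide by a minimal polynomial but eliminates with integers, and every cancellation in the field
-- rests on an explicit nonvanishing.
--
-- Coefficient lists may end in zeros, so polynomial identities are stated as equality of integer
-- values. The ring solver can rearrange values, and `coeff-vanish` leads back to coefficients.

Poly : Set
Poly = List ℤ

coeff : Poly → ℕ → ℤ
coeff []      _       = + 0
coeff (c ∷ p) zero    = c
coeff (c ∷ p) (suc i) = coeff p i

infixl 6 _⊕_
infixl 7 _⊗_ _·_

_⊕_ : Poly → Poly → Poly
[]      ⊕ q       = q
(a ∷ p) ⊕ []      = a ∷ p
(a ∷ p) ⊕ (b ∷ q) = (a ℤ.+ b) ∷ (p ⊕ q)

_·_ : ℤ → Poly → Poly
a · p = map (a ℤ.*_) p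

_⊗_ : Poly → Poly → Poly
[]      ⊗ q = []
(a ∷ p) ⊗ q = a · q ⊕ (+ 0 ∷ (p ⊗ q))

shift : ℕ → Poly → Poly
shift zero    p = p
shift (suc n) p = + 0 ∷ shift n p

[1+z]⊗_ : Poly → Poly
[1+z]⊗ p = p ⊕ (+ 0 ∷ p)

-- P(1 + z), by Horner's scheme. It turns the root ζ of a polynomial into the root ζ - 1, for which
-- the minimal relation has Eisenstein form.
translate : Poly → Poly
translate []      = []
translate (c ∷ p) = (c ∷ []) ⊕ ([1+z]⊗ translate p)

coeff-⊕ : ∀ p q i → coeff (p ⊕ q) i ≡ coeff p i ℤ.+ coeff q i
coeff-⊕ []      q       i       = sym (ℤₚ.+-identityˡ _)
coeff-⊕ (a ∷ p) []      i       = sym (ℤₚ.+-identityʳ _)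
coeff-⊕ (a ∷ p) (b ∷ q) zero    = refl
coeff-⊕ (a ∷ p) (b ∷ q) (suc i) = coeff-⊕ p q i

coeff-· : ∀ a p i → coeff (a · p) i ≡ a ℤ.* coeff p i
coeff-· a []      i       = sym (ℤₚ.*-zeroʳ a)
coeff-· a (b ∷ p) zero    = refl
coeff-· a (b ∷ p) (suc i) = coeff-· a p i

-- Evaluation of integer polynomials in a commutative ring.

module Evaluation {c ℓ} (R : CommutativeRing c ℓ)
  (hom : CommutativeRing.rawRing ℤₚ.+-*-commutativeRing -Raw-AlmostCommutative⟶ fromCommutativeRing R)
  where

  open CommutativeRing R
    using (Carrier; _≈_; 0#; 1#; +-congˡ; +-congʳ; +-cong; *-congˡ; *-congʳ; *-cong; setoid; semiring;
           +-identityˡ; +-identityʳ; *-identityˡ; *-identityʳ; zeroˡ; zeroʳ)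
    renaming (_+_ to _+ᴿ_; _*_ to _*ᴿ_; -_ to -ᴿ_; refl to ≈-refl; sym to ≈-sym; trans to ≈-trans; reflexive to ≈-reflexive)
  open _-Raw-AlmostCommutative⟶_ hom public
    using (+-homo; *-homo; -‿homo; 0-homo; 1-homo) renaming (⟦_⟧ to φ)
  open import Algebra.Properties.Semiring.Exp semiring using (_^_)
  private
    φ-≟ : ∀ a b → Maybe (φ a ≈ φ b)
    φ-≟ a b with a ℤ.≟ b
    ... | yes refl = just ≈-refl
    ... | no _     = nothing

  open import Algebra.Solver.Ring (CommutativeRing.rawRing ℤₚ.+-*-commutativeRing) (fromCommutativeRing R) hom φ-≟
    public using (solve; _:=_; _:+_; _:*_; :-_; con)
  open import Relation.Binary.Reasoning.Setoid setoid

  eval : Poly → Carrier → Carrier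
  eval []      x = 0#
  eval (c ∷ p) x = φ c +ᴿ x *ᴿ eval p x

  eval-⊕ : ∀ p q x → eval (p ⊕ q) x ≈ eval p x +ᴿ eval q x
  eval-⊕ []      q       x = ≈-sym (+-identityˡ _)
  eval-⊕ (a ∷ p) []      x = ≈-sym (+-identityʳ _)
  eval-⊕ (a ∷ p) (b ∷ q) x = begin
    φ (a ℤ.+ b) +ᴿ x *ᴿ eval (p ⊕ q) x
      ≈⟨ +-cong (+-homo a b) (*-congˡ (eval-⊕ p q x)) ⟩
    (φ a +ᴿ φ b) +ᴿ x *ᴿ (eval p x +ᴿ eval q x)
      ≈⟨ solve 5 (λ a b x p q → (a :+ b) :+ x :* (p :+ q) := (a :+ x :* p) :+ (b :+ x :* q)) ≈-refl _ _ _ _ _ ⟩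
    (φ a +ᴿ x *ᴿ eval p x) +ᴿ (φ b +ᴿ x *ᴿ eval q x) ∎

  eval-· : ∀ a p x → eval (a · p) x ≈ φ a *ᴿ eval p x
  eval-· a []      x = ≈-sym (zeroʳ _)
  eval-· a (b ∷ p) x = begin
    φ (a ℤ.* b) +ᴿ x *ᴿ eval (a · p) x
      ≈⟨ +-cong (*-homo a b) (*-congˡ (eval-· a p x)) ⟩
    φ a *ᴿ φ b +ᴿ x *ᴿ (φ a *ᴿ eval p x)
      ≈⟨ solve 4 (λ a b x p → a :* b :+ x :* (a :* p) := a :* (b :+ x :* p)) ≈-refl _ _ _ _ ⟩
    φ a *ᴿ (φ b +ᴿ x *ᴿ eval p x) ∎

  eval-0∷ : ∀ p x → eval (+ 0 ∷ p) x ≈ x *ᴿ eval p x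
  eval-0∷ p x = ≈-trans (+-congʳ 0-homo) (+-identityˡ _)

  eval-⊗ : ∀ p q x → eval (p ⊗ q) x ≈ eval p x *ᴿ eval q x
  eval-⊗ []      q x = ≈-sym (zeroˡ _)
  eval-⊗ (a ∷ p) q x = begin
    eval (a · q ⊕ (+ 0 ∷ p ⊗ q)) x
      ≈⟨ eval-⊕ (a · q) _ x ⟩
    eval (a · q) x +ᴿ eval (+ 0 ∷ p ⊗ q) x
      ≈⟨ +-cong (eval-· a q x) (≈-trans (eval-0∷ (p ⊗ q) x) (*-congˡ (eval-⊗ p q x))) ⟩
    φ a *ᴿ eval q x +ᴿ x *ᴿ (eval p x *ᴿ eval q x)
      ≈⟨ solve 4 (λ a q x p → a :* q :+ x :* (p :* q) := (a :+ x :* p) :* q) ≈-refl _ _ _ _ ⟩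
    (φ a +ᴿ x *ᴿ eval p x) *ᴿ eval q x ∎

  eval-const : ∀ a x → eval (a ∷ []) x ≈ φ a
  eval-const a x = ≈-trans (+-congˡ (zeroʳ x)) (+-identityʳ _)

  eval-shift : ∀ n p x → eval (shift n p) x ≈ (x ^ n) *ᴿ eval p x
  eval-shift zero    p x = ≈-sym (*-identityˡ _)
  eval-shift (suc n) p x = begin
    eval (+ 0 ∷ shift n p) x      ≈⟨ eval-0∷ (shift n p) x ⟩
    x *ᴿ eval (shift n p) x       ≈⟨ *-congˡ (eval-shift n p x) ⟩
    x *ᴿ ((x ^ n) *ᴿ eval p x)    ≈⟨ solve 3 (λ x y z → x :* (y :* z) := (x :* y) :* z) ≈-refl _ _ _ ⟩
    (x *ᴿ (x ^ n)) *ᴿ eval p x    ∎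

  eval-[1+z]⊗ : ∀ p y → eval ([1+z]⊗ p) y ≈ (1# +ᴿ y) *ᴿ eval p y
  eval-[1+z]⊗ p y = begin
    eval (p ⊕ (+ 0 ∷ p)) y        ≈⟨ eval-⊕ p _ y ⟩
    eval p y +ᴿ eval (+ 0 ∷ p) y  ≈⟨ +-cong (≈-sym (*-identityˡ _)) (eval-0∷ p y) ⟩
    1# *ᴿ eval p y +ᴿ y *ᴿ eval p y ≈⟨ CommutativeRing.distribʳ R _ _ _ ⟨
    (1# +ᴿ y) *ᴿ eval p y         ∎

  eval-translate : ∀ p y → eval (translate p) y ≈ eval p (1# +ᴿ y)
  eval-translate []      y = ≈-refl
  eval-translate (c ∷ p) y = begin
    eval ((c ∷ []) ⊕ ([1+z]⊗ translate p)) y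
      ≈⟨ eval-⊕ (c ∷ []) ([1+z]⊗ translate p) y ⟩
    eval (c ∷ []) y +ᴿ eval ([1+z]⊗ translate p) y
      ≈⟨ +-cong (eval-const c y) (≈-trans (eval-[1+z]⊗ (translate p) y) (*-congˡ (eval-translate p y))) ⟩
    φ c +ᴿ (1# +ᴿ y) *ᴿ eval p (1# +ᴿ y) ∎

  eval-cong : ∀ p {x x′} → x ≈ x′ → eval p x ≈ eval p x′
  eval-cong []      x≈x′ = ≈-refl
  eval-cong (c ∷ p) x≈x′ = +-congˡ (*-cong x≈x′ (eval-cong p x≈x′))

  eval-zero : ∀ p x → (∀ i → coeff p i ≡ + 0) → eval p x ≈ 0#
  eval-zero []      x p≡0 = ≈-refl
  eval-zero (c ∷ p) x p≡0 = begin
    φ c +ᴿ x *ᴿ eval p x ≈⟨ +-cong (≈-trans (≈-reflexive (cong φ (p≡0 0))) 0-homo) (*-congˡ (eval-zero p x (λ i → p≡0 (suc i)))) ⟩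
    0# +ᴿ x *ᴿ 0#        ≈⟨ +-identityˡ _ ⟩
    x *ᴿ 0#              ≈⟨ zeroʳ x ⟩
    0#                   ∎

  -- Coefficient functions of a fixed length, in place of lists, so that relations of one length can
  -- be combined entry by entry.
  evalUpTo : ℕ → (ℕ → ℤ) → Carrier → Carrier
  evalUpTo zero    c x = 0#
  evalUpTo (suc d) c x = φ (c 0) +ᴿ x *ᴿ evalUpTo d (λ i → c (suc i)) x

  eval≈evalUpTo : ∀ p d x → (∀ i → d ≤ i → coeff p i ≡ + 0) → eval p x ≈ evalUpTo d (coeff p) x
  eval≈evalUpTo p       zero    x h = eval-zero p x (λ i → h i z≤n)
  eval≈evalUpTo []      (suc d) x h = begin
    0#                              ≈⟨ zeroʳ x ⟨
    x *ᴿ 0#                         ≈⟨ *-congˡ (eval≈evalUpTo [] d x (λ _ _ → refl)) ⟩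
    x *ᴿ evalUpTo d (coeff []) x    ≈⟨ +-identityˡ _ ⟨
    0# +ᴿ x *ᴿ evalUpTo d (coeff []) x ≈⟨ +-congʳ 0-homo ⟨
    φ (+ 0) +ᴿ x *ᴿ evalUpTo d (coeff []) x ∎
  eval≈evalUpTo (c ∷ p) (suc d) x h = +-congˡ (*-congˡ (eval≈evalUpTo p d x (λ i d≤i → h (suc i) (s≤s d≤i))))

  evalUpTo-cong : ∀ d {c c′} x → (∀ i → i < d → c i ≡ c′ i) → evalUpTo d c x ≈ evalUpTo d c′ x
  evalUpTo-cong zero    x h = ≈-refl
  evalUpTo-cong (suc d) x h = +-cong (≈-reflexive (cong φ (h 0 (s≤s z≤n)))) (*-congˡ (evalUpTo-cong d x (λ i i<d → h (suc i) (s≤s i<d))))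

  evalUpTo-- : ∀ d c c′ x → evalUpTo d (λ i → c i ℤ.- c′ i) x ≈ evalUpTo d c x +ᴿ (-ᴿ evalUpTo d c′ x)
  evalUpTo-- zero    c c′ x = ≈-sym (CommutativeRing.-‿inverseʳ R 0#)
  evalUpTo-- (suc d) c c′ x = begin
    φ (c 0 ℤ.- c′ 0) +ᴿ x *ᴿ evalUpTo d (λ i → c (suc i) ℤ.- c′ (suc i)) x
      ≈⟨ +-cong (≈-trans (+-homo (c 0) (ℤ.- c′ 0)) (+-congˡ (-‿homo (c′ 0)))) (*-congˡ (evalUpTo-- d _ _ x)) ⟩
    (φ (c 0) +ᴿ (-ᴿ φ (c′ 0))) +ᴿ x *ᴿ (evalUpTo d (λ i → c (suc i)) x +ᴿ (-ᴿ evalUpTo d (λ i → c′ (suc i)) x))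
      ≈⟨ solve 5 (λ a b x e f → (a :+ (:- b)) :+ x :* (e :+ (:- f)) := (a :+ x :* e) :+ (:- (b :+ x :* f))) ≈-refl _ _ _ _ _ ⟩
    evalUpTo (suc d) c x +ᴿ (-ᴿ evalUpTo (suc d) c′ x) ∎

  evalUpTo-* : ∀ d a c x → evalUpTo d (λ i → a ℤ.* c i) x ≈ φ a *ᴿ evalUpTo d c x
  evalUpTo-* zero    a c x = ≈-sym (zeroʳ _)
  evalUpTo-* (suc d) a c x = begin
    φ (a ℤ.* c 0) +ᴿ x *ᴿ evalUpTo d (λ i → a ℤ.* c (suc i)) x
      ≈⟨ +-cong (*-homo a (c 0)) (*-congˡ (evalUpTo-* d a _ x)) ⟩
    φ a *ᴿ φ (c 0) +ᴿ x *ᴿ (φ a *ᴿ evalUpTo d (λ i → c (suc i)) x)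
      ≈⟨ solve 4 (λ a b x e → a :* b :+ x :* (a :* e) := a :* (b :+ x :* e)) ≈-refl _ _ _ _ ⟩
    φ a *ᴿ evalUpTo (suc d) c x ∎

  evalUpTo-suc : ∀ d c x → evalUpTo (suc d) c x ≈ evalUpTo d c x +ᴿ φ (c d) *ᴿ (x ^ d)
  evalUpTo-suc zero    c x = begin
    φ (c 0) +ᴿ x *ᴿ 0#         ≈⟨ +-cong (≈-sym (*-identityʳ _)) (zeroʳ x) ⟩
    φ (c 0) *ᴿ 1# +ᴿ 0#        ≈⟨ CommutativeRing.+-comm R _ _ ⟩
    0# +ᴿ φ (c 0) *ᴿ 1#        ∎
  evalUpTo-suc (suc d) c x = begin
    φ (c 0) +ᴿ x *ᴿ evalUpTo (suc d) (λ i → c (suc i)) x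
      ≈⟨ +-congˡ (*-congˡ (evalUpTo-suc d (λ i → c (suc i)) x)) ⟩
    φ (c 0) +ᴿ x *ᴿ (evalUpTo d (λ i → c (suc i)) x +ᴿ φ (c (suc d)) *ᴿ (x ^ d))
      ≈⟨ solve 5 (λ a x e b y → a :+ x :* (e :+ b :* y) := (a :+ x :* e) :+ b :* (x :* y)) ≈-refl _ _ _ _ _ ⟩
    evalUpTo (suc d) c x +ᴿ φ (c (suc d)) *ᴿ (x ^ suc d) ∎

module ℤ-Evaluation = Evaluation ℤₚ.+-*-commutativeRing (-raw-almostCommutative⟶ (fromCommutativeRing ℤₚ.+-*-commutativeRing))

open ℤ-Evaluation using () renaming (eval to evalℤ; eval-⊕ to evalℤ-⊕; eval-· to evalℤ-·; eval-⊗ to evalℤ-⊗;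
  eval-const to evalℤ-const; eval-shift to evalℤ-shift; eval-zero to evalℤ-zero; eval-translate to evalℤ-translate)

-- Integer polynomials: values, degrees, divisibility, and the polynomials zⁿ - 1.

module IntegerPolynomials where
  open import Algebra.Properties.Semiring.Exp (CommutativeRing.semiring ℤₚ.+-*-commutativeRing) using (_^_; ^-homo-*)
  open ≡-Reasoning

  -- Evaluation at the integers x + 2, where no 1 - zⁿ (n ≥ 1) vanishes.
  infix 9 _at_
  _at_ : Poly → ℕ → ℤ
  p at x = evalℤ p (+ (2 ℕ.+ x))

  infix 4 _≐_
  _≐_ : Poly → Poly → Set
  p ≐ q = ∀ x → p at x ≡ q at x

  i+j≡0⇒∣i∣≡∣j∣ : ∀ i j → i ℤ.+ j ≡ + 0 → ∣ i ∣ ≡ ∣ j ∣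
  i+j≡0⇒∣i∣≡∣j∣ i j eq = trans (cong ∣_∣ i≡-j) (ℤₚ.∣-i∣≡∣i∣ j)
    where
    i≡-j : i ≡ ℤ.- j
    i≡-j = ℤₚ.i-j≡0⇒i≡j i (ℤ.- j) (trans (cong (λ t → i ℤ.+ t) (ℤₚ.neg-involutive j)) eq)

  -- At the point `X`, chosen larger than the absolute value of the constant term `c`, vanishing
  -- makes `X` divide `c`, so `c` is 0. Every sample point is nonzero and can then be cancelled,
  -- which leaves the same claim for the tail.
  coeff-vanish : ∀ p → (∀ x → p at x ≡ + 0) → ∀ i → coeff p i ≡ + 0
  coeff-vanish []      h i = refl
  coeff-vanish (c ∷ p) h   = λ { zero → c≡0 ; (suc i) → coeff-vanish p tail≡0 i }
    where
    X : ℤ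
    X = + (2 ℕ.+ ∣ c ∣)
    ∣c∣≡ : ∣ c ∣ ≡ (2 ℕ.+ ∣ c ∣) ℕ.* ∣ evalℤ p X ∣
    ∣c∣≡ = trans (i+j≡0⇒∣i∣≡∣j∣ c _ (h ∣ c ∣)) (ℤₚ.abs-* X (evalℤ p X))
    small : ∀ m n → m ≡ (2 ℕ.+ m) ℕ.* n → m ≡ 0
    small m zero    eq = trans eq (ℕₚ.*-zeroʳ m)
    small m (suc n) eq = contradiction (ℕₚ.≤-trans (ℕₚ.m≤m*n (2 ℕ.+ m) (suc n)) (ℕₚ.≤-reflexive (sym eq)))
                                       (ℕₚ.<⇒≱ (ℕₚ.m<n+m m (s≤s (z≤n {1}))))
    c≡0 : c ≡ + 0
    c≡0 = ℤₚ.∣i∣≡0⇒i≡0 (small ∣ c ∣ ∣ evalℤ p X ∣ ∣c∣≡)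
    tail≡0 : ∀ x → p at x ≡ + 0
    tail≡0 x = ℤₚ.*-cancelˡ-≡ (+ (2 ℕ.+ x)) (p at x) (+ 0) (begin
      + (2 ℕ.+ x) ℤ.* p at x          ≡⟨ ℤₚ.+-identityˡ _ ⟨
      + 0 ℤ.+ + (2 ℕ.+ x) ℤ.* p at x  ≡⟨ cong (ℤ._+ + (2 ℕ.+ x) ℤ.* p at x) c≡0 ⟨
      c ℤ.+ + (2 ℕ.+ x) ℤ.* p at x    ≡⟨ h x ⟩
      + 0                             ≡⟨ ℤₚ.*-zeroʳ (+ (2 ℕ.+ x)) ⟨
      + (2 ℕ.+ x) ℤ.* + 0             ∎)

  at-⊕ : ∀ p q x → (p ⊕ q) at x ≡ p at x ℤ.+ q at x
  at-⊕ p q x = evalℤ-⊕ p q _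

  at-· : ∀ a p x → (a · p) at x ≡ a ℤ.* p at x
  at-· a p x = evalℤ-· a p _

  at-⊗ : ∀ p q x → (p ⊗ q) at x ≡ p at x ℤ.* q at x
  at-⊗ p q x = evalℤ-⊗ p q _

  infixl 6 _⊖_
  _⊖_ : Poly → Poly → Poly
  p ⊖ q = p ⊕ (-[1+ 0 ] · q)

  at-⊖ : ∀ p q x → (p ⊖ q) at x ≡ p at x ℤ.- q at x
  at-⊖ p q x = trans (at-⊕ p _ x) (cong (λ t → p at x ℤ.+ t) (trans (at-· -[1+ 0 ] q x) (ℤₚ.-1*i≡-i (q at x))))

  coeff-⊖ : ∀ p q i → coeff (p ⊖ q) i ≡ coeff p i ℤ.- coeff q i
  coeff-⊖ p q i = trans (coeff-⊕ p _ i) (cong (λ t → coeff p i ℤ.+ t) (trans (coeff-· -[1+ 0 ] q i) (ℤₚ.-1*i≡-i (coeff q i))))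

  ≐⇒⊖-vanish : ∀ p q → p ≐ q → ∀ i → coeff (p ⊖ q) i ≡ + 0
  ≐⇒⊖-vanish p q p≐q = coeff-vanish (p ⊖ q) (λ x → trans (at-⊖ p q x) (ℤₚ.i≡j⇒i-j≡0 (p≐q x)))

  ≐⇒coeff≡ : ∀ p q → p ≐ q → ∀ i → coeff p i ≡ coeff q i
  ≐⇒coeff≡ p q p≐q i = ℤₚ.i-j≡0⇒i≡j _ _ (trans (sym (coeff-⊖ p q i)) (≐⇒⊖-vanish p q p≐q i))

  Deg≤ : ℕ → Poly → Set
  Deg≤ d p = ∀ i → d < i → coeff p i ≡ + 0

  Monic : ℕ → Poly → Set
  Monic d p = coeff p d ≡ + 1 × Deg≤ d p

  coeff-0⊗ : ∀ p q → (∀ i → coeff p i ≡ + 0) → ∀ i → coeff (p ⊗ q) i ≡ + 0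
  coeff-0⊗ []      q h i = refl
  coeff-0⊗ (a ∷ p) q h i = begin
    coeff (a · q ⊕ (+ 0 ∷ p ⊗ q)) i                 ≡⟨ coeff-⊕ (a · q) _ i ⟩
    coeff (a · q) i ℤ.+ coeff (+ 0 ∷ p ⊗ q) i       ≡⟨ cong₂ ℤ._+_ (coeff-· a q i) (tail i) ⟩
    a ℤ.* coeff q i ℤ.+ + 0                         ≡⟨ cong (λ t → t ℤ.* coeff q i ℤ.+ + 0) (h 0) ⟩
    + 0                                             ∎
    where
    tail : ∀ i → coeff (+ 0 ∷ p ⊗ q) i ≡ + 0
    tail zero    = refl
    tail (suc i) = coeff-0⊗ p q (λ j → h (suc j)) i

  Deg≤-⊗ : ∀ p q {a b} → Deg≤ a p → Deg≤ b q → Deg≤ (a ℕ.+ b) (p ⊗ q)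
  coeff-⊗-top : ∀ p q {a b} → Deg≤ a p → Deg≤ b q → coeff (p ⊗ q) (a ℕ.+ b) ≡ coeff p a ℤ.* coeff q b

  Deg≤-⊗ []      q         hp hq i       _   = refl
  Deg≤-⊗ (c ∷ p) q {a} {b} hp hq (suc i) a+b<i = begin
    coeff (c · q ⊕ (+ 0 ∷ p ⊗ q)) (suc i)           ≡⟨ coeff-⊕ (c · q) _ (suc i) ⟩
    coeff (c · q) (suc i) ℤ.+ coeff (p ⊗ q) i       ≡⟨ cong₂ ℤ._+_ (trans (coeff-· c q (suc i)) (cong (c ℤ.*_) (hq (suc i) b<i))) (tail a hp a+b<i) ⟩
    c ℤ.* + 0 ℤ.+ + 0                               ≡⟨ trans (ℤₚ.+-identityʳ _) (ℤₚ.*-zeroʳ c) ⟩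
    + 0                                             ∎
    where
    b<i : b < suc i
    b<i = ℕₚ.≤-<-trans (ℕₚ.m≤n+m b a) a+b<i
    tail : ∀ a → Deg≤ a (c ∷ p) → a ℕ.+ b < suc i → coeff (p ⊗ q) i ≡ + 0
    tail zero    hp _ = coeff-0⊗ p q (λ j → hp (suc j) (s≤s z≤n)) i
    tail (suc a) hp (s≤s lt) = Deg≤-⊗ p q (λ j a<j → hp (suc j) (s≤s a<j)) hq i lt

  coeff-⊗-top []      q                 hp hq = refl
  coeff-⊗-top (c ∷ p) q {zero}  {b}     hp hq = begin
    coeff (c · q ⊕ (+ 0 ∷ p ⊗ q)) b                 ≡⟨ coeff-⊕ (c · q) _ b ⟩
    coeff (c · q) b ℤ.+ coeff (+ 0 ∷ p ⊗ q) b       ≡⟨ cong₂ ℤ._+_ (coeff-· c q b) (tail b) ⟩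
    c ℤ.* coeff q b ℤ.+ + 0                         ≡⟨ ℤₚ.+-identityʳ _ ⟩
    c ℤ.* coeff q b                                 ∎
    where
    tail : ∀ i → coeff (+ 0 ∷ p ⊗ q) i ≡ + 0
    tail zero    = refl
    tail (suc i) = coeff-0⊗ p q (λ j → hp (suc j) (s≤s z≤n)) i
  coeff-⊗-top (c ∷ p) q {suc a} {b} hp hq = begin
    coeff (c · q ⊕ (+ 0 ∷ p ⊗ q)) (suc a ℕ.+ b)         ≡⟨ coeff-⊕ (c · q) _ (suc a ℕ.+ b) ⟩
    coeff (c · q) (suc a ℕ.+ b) ℤ.+ coeff (p ⊗ q) (a ℕ.+ b)
      ≡⟨ cong₂ ℤ._+_ (trans (coeff-· c q (suc a ℕ.+ b)) (cong (c ℤ.*_) (hq (suc a ℕ.+ b) (s≤s (ℕₚ.m≤n+m b a)))))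
                     (coeff-⊗-top p q (λ j a<j → hp (suc j) (s≤s a<j)) hq) ⟩
    c ℤ.* + 0 ℤ.+ coeff p a ℤ.* coeff q b               ≡⟨ cong (ℤ._+ coeff p a ℤ.* coeff q b) (ℤₚ.*-zeroʳ c) ⟩
    + 0 ℤ.+ coeff p a ℤ.* coeff q b                     ≡⟨ ℤₚ.+-identityˡ _ ⟩
    coeff p a ℤ.* coeff q b                             ∎

  Monic-⊗ : ∀ p q {a b} → Monic a p → Monic b q → Monic (a ℕ.+ b) (p ⊗ q)
  Monic-⊗ p q {a} {b} (pa , hp) (qb , hq) =
    trans (coeff-⊗-top p q {a} {b} hp hq) (cong₂ ℤ._*_ pa qb) , Deg≤-⊗ p q {a} {b} hp hq

  zero-or-leading : ∀ p → (∀ i → coeff p i ≡ + 0) ⊎ ∃ λ d → coeff p d ≢ + 0 × Deg≤ d p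
  zero-or-leading []      = inj₁ (λ _ → refl)
  zero-or-leading (c ∷ p) with zero-or-leading p
  ... | inj₂ (d , p≢0 , hp) = inj₂ (suc d , p≢0 , λ { (suc i) (s≤s d<i) → hp i d<i })
  ... | inj₁ p≡0 with c ℤ.≟ + 0
  ...   | yes c≡0 = inj₁ (λ { zero → c≡0 ; (suc i) → p≡0 i })
  ...   | no  c≢0 = inj₂ (0 , c≢0 , λ { (suc i) _ → p≡0 i })

  -- Because `p` is monic, the coefficient of the product at a + b is the leading coefficient of
  -- `q`, hence nonzero. So a + b can lie neither above nor below `c`. Exact quotients by monic
  -- polynomials are thus monic, with a known degree.
  Monic-cancelˡ : ∀ p q {a c} → Monic a p → Monic c (p ⊗ q) → ∃ λ b → a ℕ.+ b ≡ c × Monic b q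
  Monic-cancelˡ p q {a} {c} (pa , hp) (pqc , hpq) with zero-or-leading q
  ... | inj₁ q≡0 = contradiction (trans (sym pqc) pq≡0) λ ()
    where
    pq≡0 : coeff (p ⊗ q) c ≡ + 0
    pq≡0 = ≐⇒coeff≡ (p ⊗ q) [] (λ x → trans (at-⊗ p q x) (trans (cong (p at x ℤ.*_) (evalℤ-zero q _ q≡0)) (ℤₚ.*-zeroʳ (p at x)))) c
  ... | inj₂ (b , qb≢0 , hq) = b , a+b≡c , (qb≡1 , hq)
    where
    top : coeff (p ⊗ q) (a ℕ.+ b) ≡ coeff q b
    top = trans (coeff-⊗-top p q {a} {b} hp hq) (trans (cong (ℤ._* coeff q b) pa) (ℤₚ.*-identityˡ _))
    a+b≡c : a ℕ.+ b ≡ c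
    a+b≡c with ℕₚ.<-cmp (a ℕ.+ b) c
    ... | tri< lt _ _ = contradiction (trans (sym pqc) (Deg≤-⊗ p q {a} {b} hp hq c lt)) λ ()
    ... | tri≈ _ eq _ = eq
    ... | tri> _ _ gt = contradiction (trans (sym top) (hpq (a ℕ.+ b) gt)) qb≢0
    qb≡1 : coeff q b ≡ + 1
    qb≡1 = trans (sym top) (trans (cong (coeff (p ⊗ q)) a+b≡c) pqc)

  Monic-resp : ∀ p q {d} → p ≐ q → Monic d p → Monic d q
  Monic-resp p q {d} p≐q (pd , hp) = trans (sym (eq d)) pd , λ i d<i → trans (sym (eq i)) (hp i d<i)
    where eq = ≐⇒coeff≡ p q p≐q

  zⁿ-1 : ℕ → Poly
  zⁿ-1 n = shift n (+ 1 ∷ []) ⊖ (+ 1 ∷ [])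

  pt : ℕ → ℤ
  pt x = + (2 ℕ.+ x)

  at-shift : ∀ n p x → shift n p at x ≡ pt x ^ n ℤ.* p at x
  at-shift n p x = evalℤ-shift n p (pt x)

  at-const : ∀ c x → (c ∷ []) at x ≡ c
  at-const c x = evalℤ-const c (pt x)

  at-zⁿ-1 : ∀ n x → (zⁿ-1 n) at x ≡ pt x ^ n ℤ.- + 1
  at-zⁿ-1 n x = begin
    (zⁿ-1 n) at x                          ≡⟨ at-⊖ (shift n (+ 1 ∷ [])) (+ 1 ∷ []) x ⟩
    shift n (+ 1 ∷ []) at x ℤ.- (+ 1 ∷ []) at x
      ≡⟨ cong₂ ℤ._-_ (trans (at-shift n (+ 1 ∷ []) x) (cong (pt x ^ n ℤ.*_) (at-const (+ 1) x))) (at-const (+ 1) x) ⟩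
    pt x ^ n ℤ.* + 1 ℤ.- + 1              ≡⟨ cong (ℤ._- + 1) (ℤₚ.*-identityʳ (pt x ^ n)) ⟩
    pt x ^ n ℤ.- + 1                      ∎

  -- Otherwise 2 + x would divide 1; this is why the sample points start at 2.
  at-zⁿ-1≢0 : ∀ n .{{_ : NonZero n}} x → (zⁿ-1 n) at x ≢ + 0
  at-zⁿ-1≢0 (suc n) x eq = contradiction (ℕₚ.m*n≡1⇒m≡1 (2 ℕ.+ x) ∣ pt x ^ n ∣ (trans (sym (ℤₚ.abs-* (pt x) (pt x ^ n))) (cong ∣_∣ power≡1))) λ ()
    where
    power≡1 : pt x ^ suc n ≡ + 1
    power≡1 = ℤₚ.i-j≡0⇒i≡j _ (+ 1) (trans (sym (at-zⁿ-1 (suc n) x)) eq)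

  coeff-shift-+ : ∀ n p i → coeff (shift n p) (n ℕ.+ i) ≡ coeff p i
  coeff-shift-+ zero    p i = refl
  coeff-shift-+ (suc n) p i = coeff-shift-+ n p i

  coeff-shift-< : ∀ n p {i} → i < n → coeff (shift n p) i ≡ + 0
  coeff-shift-< (suc n) p {zero}  _         = refl
  coeff-shift-< (suc n) p {suc i} (s≤s i<n) = coeff-shift-< n p i<n

  Monic-shift : ∀ n p {d} → Monic d p → Monic (n ℕ.+ d) (shift n p)
  Monic-shift zero    p h = h
  Monic-shift (suc n) p h with (top , low) ← Monic-shift n p h = top , λ { (suc i) (s≤s lt) → low i lt }

  Monic-zⁿ-1 : ∀ n .{{_ : NonZero n}} → Monic n (zⁿ-1 n)
  Monic-zⁿ-1 n@(suc n-1) = trans (coeffs n (s≤s z≤n)) (trans (cong (coeff (shift n (+ 1 ∷ []))) (sym (ℕₚ.+-identityʳ n))) (proj₁ monomial)) ,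
    λ i n<i → trans (coeffs i (ℕₚ.≤-trans (s≤s z≤n) n<i)) (proj₂ monomial i (subst (_< i) (sym (ℕₚ.+-identityʳ n)) n<i))
    where
    monomial : Monic (n ℕ.+ 0) (shift n (+ 1 ∷ []))
    monomial = Monic-shift n (+ 1 ∷ []) (refl , λ { (suc i) _ → refl })
    coeffs : ∀ i → 0 < i → coeff (zⁿ-1 n) i ≡ coeff (shift n (+ 1 ∷ [])) i
    coeffs (suc i) _ = trans (coeff-⊖ (shift n (+ 1 ∷ [])) (+ 1 ∷ []) (suc i)) (ℤₚ.+-identityʳ _)

  -- The sum 1 + zⁿ + ... + z^((h-1)n), that is, (z^(hn) - 1) / (zⁿ - 1).
  geometric : ℕ → ℕ → Poly
  geometric n zero    = []
  geometric n (suc h) = (+ 1 ∷ []) ⊕ shift n (geometric n h)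

  at-geometric : ∀ n h x → (zⁿ-1 (h ℕ.* n)) at x ≡ geometric n h at x ℤ.* (zⁿ-1 n) at x
  at-geometric n zero    x = at-zⁿ-1 0 x
  at-geometric n (suc h) x = begin
    (zⁿ-1 (n ℕ.+ h ℕ.* n)) at x                    ≡⟨ at-zⁿ-1 (n ℕ.+ h ℕ.* n) x ⟩
    pt x ^ (n ℕ.+ h ℕ.* n) ℤ.- + 1                ≡⟨ cong (ℤ._- + 1) (^-homo-* (pt x) n (h ℕ.* n)) ⟩
    P ℤ.* Q ℤ.- + 1                               ≡⟨ split P Q ⟩
    (P ℤ.- + 1) ℤ.+ P ℤ.* (Q ℤ.- + 1)             ≡⟨ cong (λ t → (P ℤ.- + 1) ℤ.+ P ℤ.* t) (trans (sym (at-zⁿ-1 (h ℕ.* n) x)) (at-geometric n h x)) ⟩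
    (P ℤ.- + 1) ℤ.+ P ℤ.* (g ℤ.* (zⁿ-1 n) at x)    ≡⟨ cong (λ t → (P ℤ.- + 1) ℤ.+ P ℤ.* (g ℤ.* t)) (at-zⁿ-1 n x) ⟩
    (P ℤ.- + 1) ℤ.+ P ℤ.* (g ℤ.* (P ℤ.- + 1))     ≡⟨ merge P g ⟩
    (+ 1 ℤ.+ P ℤ.* g) ℤ.* (P ℤ.- + 1)
      ≡⟨ cong₂ ℤ._*_ (trans (at-⊕ (+ 1 ∷ []) (shift n (geometric n h)) x) (cong₂ ℤ._+_ (at-const (+ 1) x) (at-shift n (geometric n h) x))) (at-zⁿ-1 n x) ⟨
    geometric n (suc h) at x ℤ.* (zⁿ-1 n) at x     ∎
    where
    P = pt x ^ n
    Q = pt x ^ (h ℕ.* n)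
    g = geometric n h at x
    split : ∀ P Q → P ℤ.* Q ℤ.- + 1 ≡ (P ℤ.- + 1) ℤ.+ P ℤ.* (Q ℤ.- + 1)
    split = solve-∀
    merge : ∀ P g → (P ℤ.- + 1) ℤ.+ P ℤ.* (g ℤ.* (P ℤ.- + 1)) ≡ (+ 1 ℤ.+ P ℤ.* g) ℤ.* (P ℤ.- + 1)
    merge = solve-∀

  infix 4 _∣ₚ_
  record _∣ₚ_ (p q : Poly) : Set where
    constructor dividesₚ
    field
      quotient : Poly
      equality : ∀ x → q at x ≡ quotient at x ℤ.* p at x

  infix 4 _∈⟨_,_⟩
  record _∈⟨_,_⟩ (g p q : Poly) : Set where
    constructor linear-combination
    field
      u v      : Poly
      equality : ∀ x → g at x ≡ u at x ℤ.* p at x ℤ.+ v at x ℤ.* q at x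

  ∣ₚ-trans : ∀ {p q r} → p ∣ₚ q → q ∣ₚ r → p ∣ₚ r
  ∣ₚ-trans {p} {q} {r} (dividesₚ s q≐) (dividesₚ t r≐) = dividesₚ (t ⊗ s) λ x → begin
    r at x                              ≡⟨ r≐ x ⟩
    t at x ℤ.* q at x                   ≡⟨ cong (t at x ℤ.*_) (q≐ x) ⟩
    t at x ℤ.* (s at x ℤ.* p at x)      ≡⟨ ℤₚ.*-assoc (t at x) (s at x) (p at x) ⟨
    t at x ℤ.* s at x ℤ.* p at x        ≡⟨ cong (ℤ._* p at x) (at-⊗ t s x) ⟨
    (t ⊗ s) at x ℤ.* p at x             ∎

  zⁿ-1-mono : ∀ {m n} → m ∣ n → zⁿ-1 m ∣ₚ zⁿ-1 n
  zⁿ-1-mono {m} (divides h refl) = dividesₚ (geometric m h) (at-geometric m h)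

  -- z^d - 1 = (z^(d + yn) - 1) - z^d (z^(yn) - 1), where the first bracket is a multiple of z^m - 1
  -- and the second of zⁿ - 1. A Bézout relation between exponents, written without subtraction, so
  -- becomes one between polynomials.
  zᵈ-1∈ : ∀ {d m n} x y → d ℕ.+ y ℕ.* n ≡ x ℕ.* m → zⁿ-1 d ∈⟨ zⁿ-1 m , zⁿ-1 n ⟩
  zᵈ-1∈ {d} {m} {n} x y eq = linear-combination (geometric m x) (-[1+ 0 ] · shift d (geometric n y)) λ t →
    let D = pt t ^ d
        E = pt t ^ (y ℕ.* n)
        M = (zⁿ-1 m) at t
        N = (zⁿ-1 n) at t
        g = geometric m x at t
        h = geometric n y at t in begin
    (zⁿ-1 d) at t                     ≡⟨ at-zⁿ-1 d t ⟩
    D ℤ.- + 1                         ≡⟨ expand D E ⟩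
    (D ℤ.* E ℤ.- + 1) ℤ.+ -[1+ 0 ] ℤ.* (D ℤ.* (E ℤ.- + 1))
      ≡⟨ cong₂ (λ a b → a ℤ.+ -[1+ 0 ] ℤ.* (D ℤ.* b))
           (trans (cong (ℤ._- + 1) (sym (^-homo-* (pt t) d (y ℕ.* n))))
             (trans (sym (at-zⁿ-1 (d ℕ.+ y ℕ.* n) t)) (trans (cong (λ k → (zⁿ-1 k) at t) eq) (at-geometric m x t))))
           (trans (sym (at-zⁿ-1 (y ℕ.* n) t)) (at-geometric n y t)) ⟩
    g ℤ.* M ℤ.+ -[1+ 0 ] ℤ.* (D ℤ.* (h ℤ.* N))
      ≡⟨ cong (λ k → g ℤ.* M ℤ.+ k) (reassoc D h N) ⟩
    g ℤ.* M ℤ.+ -[1+ 0 ] ℤ.* (D ℤ.* h) ℤ.* N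
      ≡⟨ cong (λ k → g ℤ.* M ℤ.+ k ℤ.* N)
           (trans (at-· -[1+ 0 ] (shift d (geometric n y)) t) (cong (-[1+ 0 ] ℤ.*_) (at-shift d (geometric n y) t))) ⟨
    g ℤ.* M ℤ.+ (-[1+ 0 ] · shift d (geometric n y)) at t ℤ.* N ∎
    where
    expand : ∀ D E → D ℤ.- + 1 ≡ (D ℤ.* E ℤ.- + 1) ℤ.+ -[1+ 0 ] ℤ.* (D ℤ.* (E ℤ.- + 1))
    expand = solve-∀
    reassoc : ∀ D h N → -[1+ 0 ] ℤ.* (D ℤ.* (h ℤ.* N)) ≡ -[1+ 0 ] ℤ.* (D ℤ.* h) ℤ.* N
    reassoc = solve-∀

  ∈-swap : ∀ {g p q} → g ∈⟨ p , q ⟩ → g ∈⟨ q , p ⟩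
  ∈-swap (linear-combination u v eq) = linear-combination v u λ x → trans (eq x) (ℤₚ.+-comm (u at x ℤ.* _) _)

  zᵍᶜᵈ-1∈ : ∀ m n → zⁿ-1 (gcd m n) ∈⟨ zⁿ-1 m , zⁿ-1 n ⟩
  zᵍᶜᵈ-1∈ m n with Bézout.identity (gcd-GCD m n)
  ... | Bézout.+- x y eq = zᵈ-1∈ x y eq
  ... | Bézout.-+ x y eq = ∈-swap (zᵈ-1∈ y x eq)

open IntegerPolynomials

-- Counting the fractions with given denominators.

module Counting where
  open ≡-Reasoning

  private variable
    k : ℕ

  -- hits N ns r decides whether r / N is a multiple of some 1 / ns i.
  hits : ℕ → (Fin k → ℕ) → ℕ → Bool
  hits {zero}  N ns r = false
  hits {suc k} N ns r = does (N ∣? r ℕ.* ns zero) ∨ hits N (ns ∘ suc) r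

  indicator : Bool → ℕ
  indicator b = if b then 1 else 0

  count : (ℕ → Bool) → ℕ → ℕ
  count f zero    = 0
  count f (suc n) = indicator (f n) ℕ.+ count f n

  count-cong : ∀ {f g} n → (∀ i → i < n → f i ≡ g i) → count f n ≡ count g n
  count-cong zero    f≗g = refl
  count-cong (suc n) f≗g = cong₂ ℕ._+_ (cong indicator (f≗g n ℕₚ.≤-refl)) (count-cong n (λ i i<n → f≗g i (ℕₚ.m≤n⇒m≤1+n i<n)))

  count-∨-∧ : ∀ f g n → count (λ i → f i ∨ g i) n ℕ.+ count (λ i → f i ∧ g i) n ≡ count f n ℕ.+ count g n
  count-∨-∧ f g zero    = refl
  count-∨-∧ f g (suc n) = begin
    (indicator (f n ∨ g n) ℕ.+ count (λ i → f i ∨ g i) n) ℕ.+ (indicator (f n ∧ g n) ℕ.+ count (λ i → f i ∧ g i) n)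
      ≡⟨ interchange (indicator (f n ∨ g n)) _ _ _ ⟩
    (indicator (f n ∨ g n) ℕ.+ indicator (f n ∧ g n)) ℕ.+ (count (λ i → f i ∨ g i) n ℕ.+ count (λ i → f i ∧ g i) n)
      ≡⟨ cong₂ ℕ._+_ (pointwise (f n) (g n)) (count-∨-∧ f g n) ⟩
    (indicator (f n) ℕ.+ indicator (g n)) ℕ.+ (count f n ℕ.+ count g n)
      ≡⟨ interchange (indicator (f n)) _ _ _ ⟩
    (indicator (f n) ℕ.+ count f n) ℕ.+ (indicator (g n) ℕ.+ count g n) ∎
    where
    interchange : ∀ a b c d → (a ℕ.+ b) ℕ.+ (c ℕ.+ d) ≡ (a ℕ.+ c) ℕ.+ (b ℕ.+ d)
    interchange = ℕ-solve-∀
    pointwise : ∀ a b → indicator (a ∨ b) ℕ.+ indicator (a ∧ b) ≡ indicator a ℕ.+ indicator b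
    pointwise true  true  = refl
    pointwise true  false = refl
    pointwise false true  = refl
    pointwise false false = refl

  count-+ : ∀ f m n → count f (m ℕ.+ n) ≡ count (λ i → f (i ℕ.+ n)) m ℕ.+ count f n
  count-+ f zero    n = refl
  count-+ f (suc m) n = trans (cong (indicator (f (m ℕ.+ n)) ℕ.+_) (count-+ f m n)) (sym (ℕₚ.+-assoc (indicator (f (m ℕ.+ n))) _ _))

  -- Divisibility by `h` is `h`-periodic, and each block of length `h` contains one multiple, its
  -- first number.
  count-multiples : ∀ h .{{_ : NonZero h}} n → count (λ i → does (h ∣? i)) (n ℕ.* h) ≡ n
  count-multiples h zero    = refl
  count-multiples h@(suc h-1) (suc n) = begin
    count (λ i → does (h ∣? i)) (h ℕ.+ n ℕ.* h)
      ≡⟨ count-+ (λ i → does (h ∣? i)) h (n ℕ.* h) ⟩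
    count (λ i → does (h ∣? (i ℕ.+ n ℕ.* h))) h ℕ.+ count (λ i → does (h ∣? i)) (n ℕ.* h)
      ≡⟨ cong₂ ℕ._+_ (trans (count-cong h periodic) (one-multiple h-1 ℕₚ.≤-refl)) (count-multiples h n) ⟩
    suc n ∎
    where
    periodic : ∀ i → i < h → does (h ∣? (i ℕ.+ n ℕ.* h)) ≡ does (h ∣? i)
    periodic i _ = does-⇔
      (mk⇔ (λ d → ℕDiv.∣m+n∣m⇒∣n (subst (h ∣_) (ℕₚ.+-comm i (n ℕ.* h)) d) (ℕDiv.n∣m*n n))
           (λ d → ℕDiv.∣m∣n⇒∣m+n d (ℕDiv.n∣m*n n)))
      (h ∣? (i ℕ.+ n ℕ.* h)) (h ∣? i)
    one-multiple : ∀ m → m < h → count (λ i → does (h ∣? i)) (suc m) ≡ 1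
    one-multiple zero    _   = cong (λ b → indicator b ℕ.+ 0) (dec-true (h ∣? 0) (h ℕDiv.∣0))
    one-multiple (suc m) m<h = cong₂ ℕ._+_
      (cong indicator (dec-false (h ∣? suc m) (ℕDiv.>⇒∤ m<h)))
      (one-multiple m (ℕₚ.<-trans (ℕₚ.n<1+n m) m<h))

  -- N divides both r n and r m exactly if it divides gcd(r n, r m) = r gcd(n, m). Intersecting sets
  -- of fractions therefore corresponds to gcds of denominators, as gcds of the polynomials do.
  hits-gcd : ∀ N n (ms : Fin k → ℕ) r → does (N ∣? r ℕ.* n) ∧ hits N ms r ≡ hits N (gcd n ∘ ms) r
  hits-gcd {zero}  N n ms r = Boolₚ.∧-zeroʳ _
  hits-gcd {suc k} N n ms r = begin
    a ∧ (does (N ∣? r ℕ.* ms zero) ∨ hits N (ms ∘ suc) r)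
      ≡⟨ Boolₚ.∧-distribˡ-∨ a _ _ ⟩
    a ∧ does (N ∣? r ℕ.* ms zero) ∨ a ∧ hits N (ms ∘ suc) r
      ≡⟨ cong₂ _∨_ (does-⇔ (mk⇔ join split) ((N ∣? r ℕ.* n) ×-dec (N ∣? r ℕ.* ms zero)) (N ∣? r ℕ.* gcd n (ms zero))) (hits-gcd N n (ms ∘ suc) r) ⟩
    does (N ∣? r ℕ.* gcd n (ms zero)) ∨ hits N (gcd n ∘ ms ∘ suc) r ∎
    where
    a = does (N ∣? r ℕ.* n)
    join : (N ∣ r ℕ.* n) × (N ∣ r ℕ.* ms zero) → N ∣ r ℕ.* gcd n (ms zero)
    join (d , e) = subst (N ∣_) (sym (GCD.c*gcd[m,n]≡gcd[cm,cn] r n (ms zero))) (gcd-greatest d e)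
    split : N ∣ r ℕ.* gcd n (ms zero) → (N ∣ r ℕ.* n) × (N ∣ r ℕ.* ms zero)
    split d = ∣-trans d (ℕDiv.*-monoʳ-∣ r (gcd[m,n]∣m n (ms zero))) , ∣-trans d (ℕDiv.*-monoʳ-∣ r (gcd[m,n]∣n n (ms zero)))

  count-hits-one : ∀ N .{{_ : NonZero N}} n .{{_ : NonZero n}} → n ∣ N → count (λ r → does (N ∣? r ℕ.* n)) N ≡ n
  count-hits-one N n (divides h refl) = begin
    count (λ r → does (h ℕ.* n ∣? r ℕ.* n)) (h ℕ.* n)
      ≡⟨ count-cong (h ℕ.* n) (λ r _ → does-⇔ (mk⇔ (ℕDiv.*-cancelʳ-∣ n) (ℕDiv.*-monoˡ-∣ n)) (h ℕ.* n ∣? r ℕ.* n) (h ∣? r)) ⟩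
    count (λ r → does (h ∣? r)) (h ℕ.* n)
      ≡⟨ cong (count (λ r → does (h ∣? r))) (ℕₚ.*-comm h n) ⟩
    count (λ r → does (h ∣? r)) (n ℕ.* h)
      ≡⟨ count-multiples h {{ℕₚ.m*n≢0⇒m≢0 h}} n ⟩
    n ∎

  -- Inclusion-exclusion for the fractions with denominator `ns zero` and those of the remaining
  -- family: the combinatorial twin of deg lcm + deg gcd = deg A + deg B.
  count-hits-suc : ∀ N .{{_ : NonZero N}} (ns : Fin (suc k) → ℕ) .{{_ : NonZero (ns zero)}} → ns zero ∣ N →
    count (hits N ns) N ℕ.+ count (hits N (gcd (ns zero) ∘ ns ∘ suc)) N ≡ ns zero ℕ.+ count (hits N (ns ∘ suc)) N
  count-hits-suc N ns n∣N = begin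
    count (hits N ns) N ℕ.+ count (hits N (gcd n ∘ ms)) N
      ≡⟨ cong (count (hits N ns) N ℕ.+_) (count-cong N (λ r _ → hits-gcd N n ms r)) ⟨
    count (λ r → f r ∨ hits N ms r) N ℕ.+ count (λ r → f r ∧ hits N ms r) N
      ≡⟨ count-∨-∧ f (hits N ms) N ⟩
    count f N ℕ.+ count (hits N ms) N
      ≡⟨ cong (ℕ._+ count (hits N ms) N) (count-hits-one N n n∣N) ⟩
    n ℕ.+ count (hits N ms) N ∎
    where
    n  = ns zero
    ms = ns ∘ suc
    f  = λ r → does (N ∣? r ℕ.* n)

open Counting

-- The monic lcm of the zⁿ - 1 over ℤ and its degree.

module CyclotomicLcm where
  open ≡-Reasoning

  private variable
    k : ℕ

  gcd-nonZero : ∀ m n .{{_ : NonZero n}} → NonZero (gcd m n)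
  gcd-nonZero m n@(suc _) = ℕ.≢-nonZero (GCD.gcd[m,n]≢0 m n (inj₂ λ ()))

  record IsLcm (ns : Fin k → ℕ) (L : Poly) : Set where
    field
      multiple : ∀ i → zⁿ-1 (ns i) ∣ₚ L
      least    : ∀ X → (∀ i → zⁿ-1 (ns i) ∣ₚ X) → L ∣ₚ X
  open IsLcm

  -- The degree is asserted for every common multiple `N`, so that the tail of a family and its gcds
  -- with a number can all be counted with one `N`.
  record MonicLcm (ns : Fin k → ℕ) : Set where
    field
      L     : Poly
      isLcm : IsLcm ns L
      monic : ∀ N .{{_ : NonZero N}} → (∀ i → ns i ∣ N) → Monic (count (hits N ns) N) L
  open MonicLcm

  -- Here G = gcd(zⁿ - 1, B).
  record Comaximal (n : ℕ) (B G : Poly) : Set where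
    field
      A′ B′ u v : Poly
      A≡A′G : ∀ x → (zⁿ-1 n) at x ≡ A′ at x ℤ.* G at x
      B≡B′G : ∀ x → B at x ≡ B′ at x ℤ.* G at x
      bézout : ∀ x → u at x ℤ.* B′ at x ℤ.+ v at x ℤ.* A′ at x ≡ + 1

  -- A simultaneous induction on the size of the family. The lcm of k + 1 polynomials uses
  -- `comaximal` for k of them, which uses `lcm-gcd∈` for the same k; that in turn uses all three
  -- statements for k - 1.
  monicLcm : (ns : Fin k → ℕ) → (∀ i → NonZero (ns i)) → MonicLcm ns

  -- The membership G = u B + v (zⁿ - 1) is divided by `G`. This is legitimate at every sample
  -- point, since `G` divides zⁿ - 1, which vanishes at none of them.
  comaximal : ∀ n .{{_ : NonZero n}} (ms : Fin k → ℕ) → (∀ i → NonZero (ms i)) →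
    ∀ B G → IsLcm ms B → IsLcm (gcd n ∘ ms) G → Comaximal n B G

  -- Distributivity gcd(lcm(z^ns - 1), z^q - 1) = lcm(z^gcd(q, ns) - 1), as ideal membership over ℤ.
  lcm-gcd∈ : (ns : Fin k → ℕ) → (∀ i → NonZero (ns i)) → ∀ q L M →
    IsLcm ns L → IsLcm (gcd q ∘ ns) M → M ∈⟨ L , zⁿ-1 q ⟩

  module Product {n} .{{_ : NonZero n}} {B G} (cm : Comaximal n B G) where
    open Comaximal cm

    B′A≡A′B : ∀ x → B′ at x ℤ.* (zⁿ-1 n) at x ≡ A′ at x ℤ.* B at x
    B′A≡A′B x = begin
      B′ at x ℤ.* (zⁿ-1 n) at x             ≡⟨ cong (B′ at x ℤ.*_) (A≡A′G x) ⟩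
      B′ at x ℤ.* (A′ at x ℤ.* G at x)      ≡⟨ swap (B′ at x) (A′ at x) (G at x) ⟩
      A′ at x ℤ.* (B′ at x ℤ.* G at x)      ≡⟨ cong (A′ at x ℤ.*_) (B≡B′G x) ⟨
      A′ at x ℤ.* B at x                    ∎
      where
      swap : ∀ b a g → b ℤ.* (a ℤ.* g) ≡ a ℤ.* (b ℤ.* g)
      swap = solve-∀

    A∣A′B : zⁿ-1 n ∣ₚ A′ ⊗ B
    A∣A′B = dividesₚ B′ λ x → trans (at-⊗ A′ B x) (sym (B′A≡A′B x))

    B∣A′B : B ∣ₚ A′ ⊗ B
    B∣A′B = dividesₚ A′ λ x → at-⊗ A′ B x

    -- Expand X = X (u B′ + v A′), and put X = s A in the first summand and X = t B in the second.
    -- Since B′ A = A′ B, both become multiples of A′ B. Bézout takes the place of unique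
    -- factorisation.
    A′B-least : ∀ X → zⁿ-1 n ∣ₚ X → B ∣ₚ X → A′ ⊗ B ∣ₚ X
    A′B-least X (dividesₚ s X≡sA) (dividesₚ t X≡tB) = dividesₚ (s ⊗ u ⊕ t ⊗ v) λ x → begin
      X at x
        ≡⟨ ℤₚ.*-identityʳ _ ⟨
      X at x ℤ.* + 1
        ≡⟨ cong (X at x ℤ.*_) (bézout x) ⟨
      X at x ℤ.* (u at x ℤ.* B′ at x ℤ.+ v at x ℤ.* A′ at x)
        ≡⟨ ℤₚ.*-distribˡ-+ (X at x) _ _ ⟩
      X at x ℤ.* (u at x ℤ.* B′ at x) ℤ.+ X at x ℤ.* (v at x ℤ.* A′ at x)
        ≡⟨ cong₂ (λ a b → a ℤ.* (u at x ℤ.* B′ at x) ℤ.+ b ℤ.* (v at x ℤ.* A′ at x)) (X≡sA x) (X≡tB x) ⟩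
      s at x ℤ.* (zⁿ-1 n) at x ℤ.* (u at x ℤ.* B′ at x) ℤ.+ t at x ℤ.* B at x ℤ.* (v at x ℤ.* A′ at x)
        ≡⟨ regroup (s at x) ((zⁿ-1 n) at x) (u at x) (B′ at x) (t at x) (B at x) (v at x) (A′ at x) ⟩
      s at x ℤ.* u at x ℤ.* (B′ at x ℤ.* (zⁿ-1 n) at x) ℤ.+ t at x ℤ.* v at x ℤ.* (A′ at x ℤ.* B at x)
        ≡⟨ cong (λ a → s at x ℤ.* u at x ℤ.* a ℤ.+ t at x ℤ.* v at x ℤ.* (A′ at x ℤ.* B at x)) (B′A≡A′B x) ⟩
      s at x ℤ.* u at x ℤ.* (A′ at x ℤ.* B at x) ℤ.+ t at x ℤ.* v at x ℤ.* (A′ at x ℤ.* B at x)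
        ≡⟨ ℤₚ.*-distribʳ-+ (A′ at x ℤ.* B at x) (s at x ℤ.* u at x) (t at x ℤ.* v at x) ⟨
      (s at x ℤ.* u at x ℤ.+ t at x ℤ.* v at x) ℤ.* (A′ at x ℤ.* B at x)
        ≡⟨ cong₂ ℤ._*_ (trans (at-⊕ (s ⊗ u) (t ⊗ v) x) (cong₂ ℤ._+_ (at-⊗ s u x) (at-⊗ t v x))) (at-⊗ A′ B x) ⟨
      (s ⊗ u ⊕ t ⊗ v) at x ℤ.* (A′ ⊗ B) at x ∎
      where
      regroup : ∀ s a u b′ t b v a′ → s ℤ.* a ℤ.* (u ℤ.* b′) ℤ.+ t ℤ.* b ℤ.* (v ℤ.* a′) ≡ s ℤ.* u ℤ.* (b′ ℤ.* a) ℤ.+ t ℤ.* v ℤ.* (a′ ℤ.* b)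
      regroup = solve-∀

    -- The inductive step of `lcm-gcd∈`. In M = M u B′ + M v A′, the factor M lies in (A, z^q - 1)
    -- through `A″` and in (B, z^q - 1) through `B″`. Multiplied by B′ and A′ respectively, it lands
    -- in (A′ B, z^q - 1), and A′ B is a multiple of L.
    gcd-∈ : ∀ {q L M A″ B″} → L ∣ₚ A′ ⊗ B → A″ ∣ₚ M → B″ ∣ₚ M →
      A″ ∈⟨ zⁿ-1 n , zⁿ-1 q ⟩ → B″ ∈⟨ B , zⁿ-1 q ⟩ → M ∈⟨ L , zⁿ-1 q ⟩
    gcd-∈ {q} {L} {M} {A″} {B″} (dividesₚ s A′B≡sL) (dividesₚ β M≡βA″) (dividesₚ α M≡αB″)
      (linear-combination x′ y′ A″≡) (linear-combination x y B″≡) =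
      linear-combination ((u ⊗ (β ⊗ x′) ⊕ v ⊗ (α ⊗ x)) ⊗ s) (u ⊗ (B′ ⊗ (β ⊗ y′)) ⊕ v ⊗ (A′ ⊗ (α ⊗ y))) λ t → begin
      M at t
        ≡⟨ ℤₚ.*-identityʳ _ ⟨
      M at t ℤ.* + 1
        ≡⟨ cong (M at t ℤ.*_) (bézout t) ⟨
      M at t ℤ.* (u at t ℤ.* B′ at t ℤ.+ v at t ℤ.* A′ at t)
        ≡⟨ ℤₚ.*-distribˡ-+ (M at t) _ _ ⟩
      M at t ℤ.* (u at t ℤ.* B′ at t) ℤ.+ M at t ℤ.* (v at t ℤ.* A′ at t)
        ≡⟨ cong₂ (λ a b → a ℤ.* (u at t ℤ.* B′ at t) ℤ.+ b ℤ.* (v at t ℤ.* A′ at t))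
             (trans (M≡βA″ t) (cong (β at t ℤ.*_) (A″≡ t))) (trans (M≡αB″ t) (cong (α at t ℤ.*_) (B″≡ t))) ⟩
      β at t ℤ.* (x′ at t ℤ.* (zⁿ-1 n) at t ℤ.+ y′ at t ℤ.* R t) ℤ.* (u at t ℤ.* B′ at t) ℤ.+
      α at t ℤ.* (x at t ℤ.* B at t ℤ.+ y at t ℤ.* R t) ℤ.* (v at t ℤ.* A′ at t)
        ≡⟨ regroup (β at t) (x′ at t) ((zⁿ-1 n) at t) (y′ at t) (R t) (u at t) (B′ at t) (α at t) (x at t) (B at t) (y at t) (v at t) (A′ at t) ⟩
      u at t ℤ.* (β at t ℤ.* x′ at t) ℤ.* (B′ at t ℤ.* (zⁿ-1 n) at t) ℤ.+ v at t ℤ.* (α at t ℤ.* x at t) ℤ.* (A′ at t ℤ.* B at t) ℤ.+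
      (u at t ℤ.* (B′ at t ℤ.* (β at t ℤ.* y′ at t)) ℤ.+ v at t ℤ.* (A′ at t ℤ.* (α at t ℤ.* y at t))) ℤ.* R t
        ≡⟨ cong₂ (λ a b → u at t ℤ.* (β at t ℤ.* x′ at t) ℤ.* a ℤ.+ v at t ℤ.* (α at t ℤ.* x at t) ℤ.* b ℤ.+
             (u at t ℤ.* (B′ at t ℤ.* (β at t ℤ.* y′ at t)) ℤ.+ v at t ℤ.* (A′ at t ℤ.* (α at t ℤ.* y at t))) ℤ.* R t)
             (trans (B′A≡A′B t) (A′B≡sL′ t)) (A′B≡sL′ t) ⟩
      u at t ℤ.* (β at t ℤ.* x′ at t) ℤ.* (s at t ℤ.* L at t) ℤ.+ v at t ℤ.* (α at t ℤ.* x at t) ℤ.* (s at t ℤ.* L at t) ℤ.+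
      (u at t ℤ.* (B′ at t ℤ.* (β at t ℤ.* y′ at t)) ℤ.+ v at t ℤ.* (A′ at t ℤ.* (α at t ℤ.* y at t))) ℤ.* R t
        ≡⟨ cong (ℤ._+ (u at t ℤ.* (B′ at t ℤ.* (β at t ℤ.* y′ at t)) ℤ.+ v at t ℤ.* (A′ at t ℤ.* (α at t ℤ.* y at t))) ℤ.* R t)
             (collect (u at t ℤ.* (β at t ℤ.* x′ at t)) (v at t ℤ.* (α at t ℤ.* x at t)) (s at t) (L at t)) ⟩
      (u at t ℤ.* (β at t ℤ.* x′ at t) ℤ.+ v at t ℤ.* (α at t ℤ.* x at t)) ℤ.* s at t ℤ.* L at t ℤ.+
      (u at t ℤ.* (B′ at t ℤ.* (β at t ℤ.* y′ at t)) ℤ.+ v at t ℤ.* (A′ at t ℤ.* (α at t ℤ.* y at t))) ℤ.* R t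
        ≡⟨ cong₂ (λ a b → a ℤ.* L at t ℤ.+ b ℤ.* R t)
             (trans (at-⊗ (u ⊗ (β ⊗ x′) ⊕ v ⊗ (α ⊗ x)) s t) (cong (ℤ._* s at t)
               (trans (at-⊕ (u ⊗ (β ⊗ x′)) _ t) (cong₂ ℤ._+_ (at-⊗³ u β x′ t) (at-⊗³ v α x t)))))
             (trans (at-⊕ (u ⊗ (B′ ⊗ (β ⊗ y′))) _ t) (cong₂ ℤ._+_
               (trans (at-⊗ u _ t) (cong (u at t ℤ.*_) (at-⊗³ B′ β y′ t)))
               (trans (at-⊗ v _ t) (cong (v at t ℤ.*_) (at-⊗³ A′ α y t))))) ⟨
      ((u ⊗ (β ⊗ x′) ⊕ v ⊗ (α ⊗ x)) ⊗ s) at t ℤ.* L at t ℤ.+ (u ⊗ (B′ ⊗ (β ⊗ y′)) ⊕ v ⊗ (A′ ⊗ (α ⊗ y))) at t ℤ.* R t ∎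
      where
      R : ℕ → ℤ
      R t = (zⁿ-1 q) at t
      A′B≡sL′ : ∀ t → A′ at t ℤ.* B at t ≡ s at t ℤ.* L at t
      A′B≡sL′ t = trans (sym (at-⊗ A′ B t)) (A′B≡sL t)
      at-⊗³ : ∀ p q r t → (p ⊗ (q ⊗ r)) at t ≡ p at t ℤ.* (q at t ℤ.* r at t)
      at-⊗³ p q r t = trans (at-⊗ p (q ⊗ r) t) (cong (p at t ℤ.*_) (at-⊗ q r t))
      regroup : ∀ β x′ a y′ c u b′ α x b y v a′ →
        β ℤ.* (x′ ℤ.* a ℤ.+ y′ ℤ.* c) ℤ.* (u ℤ.* b′) ℤ.+ α ℤ.* (x ℤ.* b ℤ.+ y ℤ.* c) ℤ.* (v ℤ.* a′) ≡
        u ℤ.* (β ℤ.* x′) ℤ.* (b′ ℤ.* a) ℤ.+ v ℤ.* (α ℤ.* x) ℤ.* (a′ ℤ.* b) ℤ.+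
        (u ℤ.* (b′ ℤ.* (β ℤ.* y′)) ℤ.+ v ℤ.* (a′ ℤ.* (α ℤ.* y))) ℤ.* c
      regroup = solve-∀
      collect : ∀ a b s l → a ℤ.* (s ℤ.* l) ℤ.+ b ℤ.* (s ℤ.* l) ≡ (a ℤ.+ b) ℤ.* s ℤ.* l
      collect = solve-∀

  monicLcm {zero} ns pos = record
    { L     = + 1 ∷ []
    ; isLcm = record
        { multiple = λ ()
        ; least    = λ X _ → dividesₚ X λ x → sym (trans (cong (X at x ℤ.*_) (at-const (+ 1) x)) (ℤₚ.*-identityʳ _)) }
    ; monic = λ N _ → subst (λ d → Monic d (+ 1 ∷ [])) (sym (count-none N N)) (refl , λ { (suc i) _ → refl }) }
    where
    count-none : ∀ N n → count (hits N ns) n ≡ 0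
    count-none N zero    = refl
    count-none N (suc n) = count-none N n
  monicLcm {suc k} ns pos = record
    { L     = A′ ⊗ B
    ; isLcm = record
        { multiple = λ { zero → A∣A′B ; (suc i) → ∣ₚ-trans (multiple (isLcm lcmB) i) B∣A′B }
        ; least    = λ X X-multiple → A′B-least X (X-multiple zero) (least (isLcm lcmB) X (X-multiple ∘ suc)) }
    ; monic = λ N h → degree N h }
    where
    n  = ns zero
    ms = ns ∘ suc
    instance _ = pos zero
    lcmB = monicLcm ms (pos ∘ suc)
    lcmG = monicLcm (gcd n ∘ ms) (λ i → gcd-nonZero n (ms i) {{pos (suc i)}})
    B = L lcmB
    G = L lcmG
    cm = comaximal n ms (pos ∘ suc) B G (isLcm lcmB) (isLcm lcmG)
    open Comaximal cm
    open Product cm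
    degree : ∀ N .{{_ : NonZero N}} → (∀ i → ns i ∣ N) → Monic (count (hits N ns) N) (A′ ⊗ B)
    -- From G A′ = zⁿ - 1 with `G` monic of degree g, the cofactor `A′` is monic of degree e = n -
    -- g; `count≡` matches e + b with the number of fractions.
    degree N ns∣N with Monic-cancelˡ G A′ (monic lcmG N (λ i → ∣-trans (gcd[m,n]∣n n (ms i)) (ns∣N (suc i))))
      (Monic-resp (zⁿ-1 n) (G ⊗ A′) (λ x → trans (A≡A′G x) (trans (ℤₚ.*-comm (A′ at x) (G at x)) (sym (at-⊗ G A′ x)))) (Monic-zⁿ-1 n))
    ... | e , g+e≡n , monicA′ = subst (λ d → Monic d (A′ ⊗ B)) (sym count≡)
            (Monic-⊗ A′ B monicA′ (monic lcmB N (ns∣N ∘ suc)))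
      where
      g = count (hits N (gcd n ∘ ms)) N
      b = count (hits N ms) N
      count≡ : count (hits N ns) N ≡ e ℕ.+ b
      count≡ = ℕₚ.+-cancelʳ-≡ g _ _ (begin
        count (hits N ns) N ℕ.+ g   ≡⟨ count-hits-suc N ns (ns∣N zero) ⟩
        n ℕ.+ b                     ≡⟨ cong (ℕ._+ b) g+e≡n ⟨
        g ℕ.+ e ℕ.+ b               ≡⟨ ℕₚ.+-assoc g e b ⟩
        g ℕ.+ (e ℕ.+ b)             ≡⟨ ℕₚ.+-comm g _ ⟩
        e ℕ.+ b ℕ.+ g               ∎)

  comaximal n ms pos B G lcmB lcmG
    with dividesₚ A′ A≡ ← least lcmG (zⁿ-1 n) (λ i → zⁿ-1-mono (gcd[m,n]∣m n (ms i)))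
       | dividesₚ B′ B≡ ← least lcmG B (λ i → ∣ₚ-trans (zⁿ-1-mono (gcd[m,n]∣n n (ms i))) (multiple lcmB i))
       | linear-combination u v G≡ ← lcm-gcd∈ ms pos n B G lcmB lcmG
    = record { A′ = A′ ; B′ = B′ ; u = u ; v = v ; A≡A′G = A≡ ; B≡B′G = B≡ ; bézout = λ x →
        ℤₚ.*-cancelʳ-≡ _ (+ 1) (G at x) {{ℤ.≢-nonZero (G≢0 x)}} (begin
          (u at x ℤ.* B′ at x ℤ.+ v at x ℤ.* A′ at x) ℤ.* G at x
            ≡⟨ expand (u at x) (B′ at x) (v at x) (A′ at x) (G at x) ⟩
          u at x ℤ.* (B′ at x ℤ.* G at x) ℤ.+ v at x ℤ.* (A′ at x ℤ.* G at x)
            ≡⟨ cong₂ (λ b a → u at x ℤ.* b ℤ.+ v at x ℤ.* a) (B≡ x) (A≡ x) ⟨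
          u at x ℤ.* B at x ℤ.+ v at x ℤ.* (zⁿ-1 n) at x
            ≡⟨ G≡ x ⟨
          G at x
            ≡⟨ ℤₚ.*-identityˡ _ ⟨
          + 1 ℤ.* G at x ∎) }
    where
    G≢0 : ∀ x → G at x ≢ + 0
    G≢0 x G≡0 with dividesₚ A′ A≡ ← least lcmG (zⁿ-1 n) (λ i → zⁿ-1-mono (gcd[m,n]∣m n (ms i)))
      = at-zⁿ-1≢0 n x (trans (A≡ x) (trans (cong (A′ at x ℤ.*_) G≡0) (ℤₚ.*-zeroʳ (A′ at x))))
    expand : ∀ u b v a g → (u ℤ.* b ℤ.+ v ℤ.* a) ℤ.* g ≡ u ℤ.* (b ℤ.* g) ℤ.+ v ℤ.* (a ℤ.* g)
    expand = solve-∀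

  lcm-gcd∈ {zero} ns pos q L M lcmL lcmM with dividesₚ r M≡ ← least lcmL M (λ ()) =
    linear-combination r [] λ x → trans (M≡ x) (sym (trans (cong (λ t → r at x ℤ.* L at x ℤ.+ t) (ℤₚ.*-zeroˡ ((zⁿ-1 q) at x))) (ℤₚ.+-identityʳ _)))
  lcm-gcd∈ {suc k} ns pos q L′ M lcmL lcmM =
    -- `L′` is an arbitrary lcm, known by its universal property: it divides the explicit common
    -- multiple `A′ ⊗ B`.
    gcd-∈ (least lcmL (A′ ⊗ B) (λ { zero → A∣A′B ; (suc i) → ∣ₚ-trans (multiple (isLcm lcmB) i) B∣A′B }))
      (multiple lcmM zero) (least (isLcm lcmB″) M (multiple lcmM ∘ suc))
      (∈-swap (zᵍᶜᵈ-1∈ q n)) (lcm-gcd∈ ms (pos ∘ suc) q B (L lcmB″) (isLcm lcmB) (isLcm lcmB″))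
    where
    n  = ns zero
    ms = ns ∘ suc
    instance _ = pos zero
    lcmB = monicLcm ms (pos ∘ suc)
    lcmG = monicLcm (gcd n ∘ ms) (λ i → gcd-nonZero n (ms i) {{pos (suc i)}})
    lcmB″ = monicLcm (gcd q ∘ ms) (λ i → gcd-nonZero q (ms i) {{pos (suc i)}})
    B = L lcmB
    cm = comaximal n ms (pos ∘ suc) B (L lcmG) (isLcm lcmB) (isLcm lcmG)
    open Comaximal cm
    open Product cm

open CyclotomicLcm

-- The embedding of ℤ in a field of characteristic zero.

module FieldProperties {c ℓ} (F : CharZeroField c ℓ) where
  open CharZeroField F renaming (_×_ to _×ᶠ_; refl to ≈-refl; sym to ≈-sym; trans to ≈-trans) hiding (_/_)
  open import Algebra.Properties.Ring (CommutativeRing.ring commutativeRing)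
    using (-‿distribˡ-*; -‿distribʳ-*; -0#≈0#; -‿involutive; -‿+-comm)
  open import Algebra.Properties.Semiring.Mult semiring using (×-homo-+; ×1-homo-*; ×-homo-1)
  open import Relation.Binary.Reasoning.Setoid setoid

  private
    infix 9 ⟨_⟩
    ⟨_⟩ : ℕ → Carrier
    ⟨ n ⟩ = n ×ᶠ 1#

  fromℤ-⊖ : ∀ m n → fromℤ (m ℤ.⊖ n) ≈ ⟨ m ⟩ - ⟨ n ⟩
  fromℤ-⊖ zero    zero    = ≈-sym (-‿inverseʳ 0#)
  fromℤ-⊖ zero    (suc n) = ≈-sym (+-identityˡ _)
  fromℤ-⊖ (suc m) zero    = ≈-sym (≈-trans (+-congˡ -0#≈0#) (+-identityʳ _))
  fromℤ-⊖ (suc m) (suc n) = begin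
    fromℤ (suc m ℤ.⊖ suc n)                    ≡⟨ cong fromℤ (ℤₚ.[1+m]⊖[1+n]≡m⊖n m n) ⟩
    fromℤ (m ℤ.⊖ n)                            ≈⟨ fromℤ-⊖ m n ⟩
    ⟨ m ⟩ - ⟨ n ⟩                            ≈⟨ +-congʳ (≈-trans (+-congˡ (-‿inverseʳ 1#)) (+-identityʳ _)) ⟨
    ⟨ m ⟩ + (1# - 1#) - ⟨ n ⟩                ≈⟨ +-congʳ (+-assoc _ _ _) ⟨
    ⟨ m ⟩ + 1# - 1# - ⟨ n ⟩                  ≈⟨ +-assoc _ _ _ ⟩
    ⟨ m ⟩ + 1# + (- 1# - ⟨ n ⟩)              ≈⟨ +-cong (+-comm _ _) (-‿+-comm 1# ⟨ n ⟩) ⟩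
    ⟨ suc m ⟩ - ⟨ suc n ⟩                    ∎

  fromℤ-+ : ∀ i j → fromℤ (i ℤ.+ j) ≈ fromℤ i + fromℤ j
  fromℤ-+ (+ m)    (+ n)    = ×-homo-+ 1# m n
  fromℤ-+ (+ m)    -[1+ n ] = fromℤ-⊖ m (suc n)
  fromℤ-+ -[1+ m ] (+ n)    = ≈-trans (fromℤ-⊖ n (suc m)) (+-comm _ _)
  fromℤ-+ -[1+ m ] -[1+ n ] = begin
    - ⟨ suc (suc (m ℕ.+ n)) ⟩                ≡⟨ cong (λ k → - ⟨ suc k ⟩) (ℕₚ.+-suc m n) ⟨
    - ⟨ suc m ℕ.+ suc n ⟩                    ≈⟨ -‿cong (×-homo-+ 1# (suc m) (suc n)) ⟩
    - (⟨ suc m ⟩ + ⟨ suc n ⟩)                ≈⟨ -‿+-comm _ _ ⟨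
    - ⟨ suc m ⟩ - ⟨ suc n ⟩                  ∎

  fromℤ-neg : ∀ i → fromℤ (ℤ.- i) ≈ - fromℤ i
  fromℤ-neg (+ zero)    = ≈-sym -0#≈0#
  fromℤ-neg (+ (suc n)) = ≈-refl
  fromℤ-neg -[1+ n ]    = ≈-sym (-‿involutive _)

  fromℤ-+◃ : ∀ n → fromℤ (Sign.+ ◃ n) ≈ ⟨ n ⟩
  fromℤ-+◃ zero    = ≈-refl
  fromℤ-+◃ (suc n) = ≈-refl

  fromℤ--◃ : ∀ n → fromℤ (Sign.- ◃ n) ≈ - ⟨ n ⟩
  fromℤ--◃ zero    = ≈-sym -0#≈0#
  fromℤ--◃ (suc n) = ≈-refl

  fromℤ-* : ∀ i j → fromℤ (i ℤ.* j) ≈ fromℤ i * fromℤ j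
  fromℤ-* (+ m)    (+ n)    = ≈-trans (fromℤ-+◃ (m ℕ.* n)) (×1-homo-* m n)
  fromℤ-* (+ m)    -[1+ n ] = begin
    fromℤ (Sign.- ◃ m ℕ.* suc n)             ≈⟨ fromℤ--◃ (m ℕ.* suc n) ⟩
    - ⟨ m ℕ.* suc n ⟩                        ≈⟨ -‿cong (×1-homo-* m (suc n)) ⟩
    - (⟨ m ⟩ * ⟨ suc n ⟩)                    ≈⟨ -‿distribʳ-* _ _ ⟩
    ⟨ m ⟩ * - ⟨ suc n ⟩                      ∎
  fromℤ-* -[1+ m ] (+ n)    = begin
    fromℤ (Sign.- ◃ suc m ℕ.* n)             ≈⟨ fromℤ--◃ (suc m ℕ.* n) ⟩
    - ⟨ suc m ℕ.* n ⟩                        ≈⟨ -‿cong (×1-homo-* (suc m) n) ⟩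
    - (⟨ suc m ⟩ * ⟨ n ⟩)                    ≈⟨ -‿distribˡ-* _ _ ⟩
    - ⟨ suc m ⟩ * ⟨ n ⟩                      ∎
  fromℤ-* -[1+ m ] -[1+ n ] = begin
    ⟨ suc m ℕ.* suc n ⟩                      ≈⟨ ×1-homo-* (suc m) (suc n) ⟩
    ⟨ suc m ⟩ * ⟨ suc n ⟩                    ≈⟨ -‿involutive _ ⟨
    - - (⟨ suc m ⟩ * ⟨ suc n ⟩)              ≈⟨ -‿cong (-‿distribʳ-* _ _) ⟩
    - (⟨ suc m ⟩ * - ⟨ suc n ⟩)              ≈⟨ -‿distribˡ-* _ _ ⟩
    - ⟨ suc m ⟩ * - ⟨ suc n ⟩                ∎

  fromℤ-hom : CommutativeRing.rawRing ℤₚ.+-*-commutativeRing -Raw-AlmostCommutative⟶ fromCommutativeRing commutativeRing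
  fromℤ-hom = record
    { ⟦_⟧    = fromℤ
    ; +-homo = fromℤ-+
    ; *-homo = fromℤ-*
    ; -‿homo = fromℤ-neg
    ; 0-homo = ≈-refl
    ; 1-homo = ×-homo-1 1#
    }

  fromℤ≈0⇒≡0 : ∀ i → fromℤ i ≈ 0# → i ≡ + 0
  fromℤ≈0⇒≡0 (+ zero)    _  = refl
  fromℤ≈0⇒≡0 (+ (suc n)) eq = contradiction eq (charZero n)
  fromℤ≈0⇒≡0 -[1+ n ]    eq = contradiction (≈-trans (≈-sym (-‿involutive _)) (≈-trans (-‿cong eq) -0#≈0#)) (charZero n)

  -- Without decidable equality a vanishing product does not split into cases; the nonzero factor
  -- has to be known and is inverted.
  *-cancelˡ-0 : ∀ {x z} → ¬ (x ≈ 0#) → x * z ≈ 0# → z ≈ 0#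
  *-cancelˡ-0 {x} {z} x≉0 xz≈0 = begin
    z                  ≈⟨ *-identityˡ z ⟨
    1# * z             ≈⟨ *-congʳ (inverseʳ x x≉0) ⟨
    x * x ⁻¹ * z       ≈⟨ *-congʳ (*-comm x (x ⁻¹)) ⟩
    x ⁻¹ * x * z       ≈⟨ *-assoc _ _ _ ⟩
    x ⁻¹ * (x * z)     ≈⟨ *-congˡ xz≈0 ⟩
    x ⁻¹ * 0#          ≈⟨ zeroʳ _ ⟩
    0#                 ∎

-- Binomial coefficients and their divisibility by a prime.

binomial : ℕ → Poly
binomial zero    = + 1 ∷ []
binomial (suc n) = [1+z]⊗ binomial n

coeff-binomial : ∀ n k → coeff (binomial n) k ≡ + (n C k)
coeff-binomial zero    zero    = refl
coeff-binomial zero    (suc k) = refl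
coeff-binomial (suc n) zero    = trans (coeff-⊕ (binomial n) _ 0) (trans (ℤₚ.+-identityʳ _) (coeff-binomial n 0))
coeff-binomial (suc n) (suc k) = begin
  coeff (binomial n ⊕ (+ 0 ∷ binomial n)) (suc k)         ≡⟨ coeff-⊕ (binomial n) _ (suc k) ⟩
  coeff (binomial n) (suc k) ℤ.+ coeff (binomial n) k     ≡⟨ cong₂ ℤ._+_ (coeff-binomial n (suc k)) (coeff-binomial n k) ⟩
  + (n C suc k ℕ.+ n C k)                                 ≡⟨ cong +_ (ℕₚ.+-comm (n C suc k) (n C k)) ⟩
  + (n C k ℕ.+ n C suc k)                                 ≡⟨ cong +_ (nCk+nC[k+1]≡[n+1]C[k+1] n k) ⟩
  + (suc n C suc k)                                       ∎
  where open ≡.≡-Reasoning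

-- The absorption identity in division-free form, by induction with Pascal's rule.
[1+k]*[1+n]C[1+k]≡[1+n]*nCk : ∀ n k → suc k ℕ.* (suc n C suc k) ≡ suc n ℕ.* (n C k)
[1+k]*[1+n]C[1+k]≡[1+n]*nCk zero    zero    = refl
[1+k]*[1+n]C[1+k]≡[1+n]*nCk zero    (suc k) = trans (cong (suc (suc k) ℕ.*_) (k>n⇒nCk≡0 {1} {suc (suc k)} (s≤s (s≤s z≤n)))) (ℕₚ.*-zeroʳ (suc (suc k)))
[1+k]*[1+n]C[1+k]≡[1+n]*nCk (suc n) zero    = trans (ℕₚ.*-identityˡ _) (trans (nC1≡n (suc (suc n))) (sym (ℕₚ.*-identityʳ _)))
[1+k]*[1+n]C[1+k]≡[1+n]*nCk (suc n) (suc k) = begin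
  suc (suc k) ℕ.* (suc (suc n) C suc (suc k))
    ≡⟨ cong (suc (suc k) ℕ.*_) (nCk+nC[k+1]≡[n+1]C[k+1] (suc n) (suc k)) ⟨
  suc (suc k) ℕ.* (suc n C suc k ℕ.+ suc n C suc (suc k))
    ≡⟨ split k (suc n C suc k) (suc n C suc (suc k)) ⟩
  suc n C suc k ℕ.+ (suc k ℕ.* (suc n C suc k) ℕ.+ suc (suc k) ℕ.* (suc n C suc (suc k)))
    ≡⟨ cong (suc n C suc k ℕ.+_) (cong₂ ℕ._+_ ([1+k]*[1+n]C[1+k]≡[1+n]*nCk n k) ([1+k]*[1+n]C[1+k]≡[1+n]*nCk n (suc k))) ⟩
  suc n C suc k ℕ.+ (suc n ℕ.* (n C k) ℕ.+ suc n ℕ.* (n C suc k))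
    ≡⟨ cong (suc n C suc k ℕ.+_) (ℕₚ.*-distribˡ-+ (suc n) (n C k) (n C suc k)) ⟨
  suc n C suc k ℕ.+ suc n ℕ.* (n C k ℕ.+ n C suc k)
    ≡⟨ cong (λ t → suc n C suc k ℕ.+ suc n ℕ.* t) (nCk+nC[k+1]≡[n+1]C[k+1] n k) ⟩
  suc (suc n) ℕ.* (suc n C suc k) ∎
  where
  open ≡.≡-Reasoning
  split : ∀ k a b → suc (suc k) ℕ.* (a ℕ.+ b) ≡ a ℕ.+ (suc k ℕ.* a ℕ.+ suc (suc k) ℕ.* b)
  split = ℕ-solve-∀

-- By absorption p divides k C(p, k), and it cannot divide k, as 0 < k < p.
prime∣C : ∀ {p k} → Prime p → 0 < k → k < p → p ∣ (p C k)
prime∣C {suc n} {suc k} p-prime _ k<p with euclidsLemma (suc k) (suc n C suc k) p-prime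
  (ℕDiv.divides (n C k) (trans ([1+k]*[1+n]C[1+k]≡[1+n]*nCk n k) (ℕₚ.*-comm (suc n) (n C k))))
... | inj₁ p∣k = contradiction p∣k (ℕDiv.>⇒∤ k<p)
... | inj₂ p∣C = p∣C

-- Linear independence over ℤ of 1, y, …, y^(p-2) for y = ζ - 1, by p-adic descent on a relation:
-- y divides p in ℤ[y], so a relation whose constant term is divisible by p may be divided by y.
-- Once the constant term is prime to p, its multiples by powers of y form a relation matrix that
-- is unitriangular up to units mod p, and eliminating in it makes an integer prime to p vanish.
module Independence {c ℓ} (F : CharZeroField c ℓ) (d′ : ℕ) (p-prime : Prime (2 ℕ.+ d′))
  (y : CharZeroField.Carrier F) where
  open CharZeroField F hiding (_/_) renaming (_×_ to _×ᶠ_; refl to ≈-refl; sym to ≈-sym; trans to ≈-trans)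
  open FieldProperties F
  open Evaluation commutativeRing fromℤ-hom
  open import Relation.Binary.Reasoning.Setoid setoid

  -- `d` = p - 1 is the length of the relations considered, so `d′` = p - 2 is the index of their
  -- top coefficient.
  p d : ℕ
  p = 2 ℕ.+ d′
  d = 1 ℕ.+ d′

  infix 4 p∣_ p∤_
  p∣_ p∤_ : ℤ → Set
  p∣ a = + p ℤDiv.∣ a
  p∤ a = ¬ (p∣ a)

  p∤-* : ∀ {a b} → p∤ a → p∤ b → p∤ (a ℤ.* b)
  p∤-* {a} {b} p∤a p∤b p∣ab =
    [ (λ p∣a → p∤a (ℤDiv.∣ᵤ⇒∣ p∣a)) , (λ p∣b → p∤b (ℤDiv.∣ᵤ⇒∣ p∣b)) ]′
      (euclidsLemma ∣ a ∣ ∣ b ∣ p-prime (subst (p ∣_) (ℤₚ.abs-* a b) (ℤDiv.∣⇒∣ᵤ p∣ab)))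

  p∤-- : ∀ {a b} → p∤ a → p∣ b → p∤ (a ℤ.- b)
  p∤-- {a} {b} p∤a p∣b p∣a-b = p∤a (subst p∣_ a-b+b≡a (ℤDiv.∣m∣n⇒∣m+n p∣a-b p∣b))
    where
    a-b+b≡a : a ℤ.- b ℤ.+ b ≡ a
    a-b+b≡a = trans (ℤₚ.+-assoc a (ℤ.- b) b) (trans (cong (λ t → a ℤ.+ t) (ℤₚ.+-inverseˡ b)) (ℤₚ.+-identityʳ a))

  p∣0 : p∣ (+ 0)
  p∣0 = ℤDiv.divides (+ 0) refl

  p∣*p* : ∀ a b → p∣ (a ℤ.* + p ℤ.* b)
  p∣*p* a b = ℤDiv.∣m⇒∣m*n b (ℤDiv.∣n⇒∣m*n a ℤDiv.∣-refl)

  IsRelation : ℕ → (ℕ → ℤ) → Set ℓ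
  IsRelation n c = evalUpTo n c y ≈ 0#

  module _ (y≉0 : ¬ (y ≈ 0#)) where
    -- Fraction-free elimination: cross-multiplying with row 0 clears column 0, and cancelling y
    -- shortens the relations by one. Modulo p the entries below the diagonal stay 0 and the
    -- diagonal is multiplied by the unit M 0 0. A single integer prime to p remains, which is 0 in
    -- the field and hence 0 in ℤ.
    triangular-absurd : ∀ n (M : ℕ → ℕ → ℤ) → (∀ i → IsRelation (suc n) (M i)) →
      (∀ {i j} → j < i → p∣ M i j) → (∀ i → p∤ M i i) → ⊥
    triangular-absurd zero M rel lower diag = diag 0 (subst p∣_ (sym (fromℤ≈0⇒≡0 (M 0 0) M₀₀≈0)) p∣0)
      where
      M₀₀≈0 : φ (M 0 0) ≈ 0#
      M₀₀≈0 = ≈-trans (≈-sym (≈-trans (+-congˡ (zeroʳ y)) (+-identityʳ _))) (rel 0)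
    triangular-absurd (suc n) M rel lower diag = triangular-absurd n M′ rel′
      (λ j<i → ℤDiv.∣m∣n⇒∣m-n (ℤDiv.∣n⇒∣m*n (M 0 0) (lower (s≤s j<i))) (ℤDiv.∣m⇒∣m*n _ (lower (s≤s z≤n))))
      (λ i → p∤-- (p∤-* (diag 0) (diag (suc i))) (ℤDiv.∣m⇒∣m*n _ (lower (s≤s z≤n))))
      where
      N M′ : ℕ → ℕ → ℤ
      N i j = M 0 0 ℤ.* M (suc i) j ℤ.- M (suc i) 0 ℤ.* M 0 j
      M′ i j = N i (suc j)
      N₀≡0 : ∀ i → N i 0 ≡ + 0
      N₀≡0 i = ℤₚ.i≡j⇒i-j≡0 (ℤₚ.*-comm (M 0 0) (M (suc i) 0))
      rel′ : ∀ i → IsRelation (suc n) (M′ i)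
      rel′ i = *-cancelˡ-0 y≉0 (begin
        y * evalUpTo (suc n) (M′ i) y                     ≈⟨ +-identityˡ _ ⟨
        φ (+ 0) + y * evalUpTo (suc n) (M′ i) y           ≡⟨ cong (λ t → φ t + y * evalUpTo (suc n) (M′ i) y) (N₀≡0 i) ⟨
        evalUpTo (suc (suc n)) (N i) y                    ≈⟨ evalUpTo-- (suc (suc n)) (λ j → M 0 0 ℤ.* M (suc i) j) (λ j → M (suc i) 0 ℤ.* M 0 j) y ⟩
        evalUpTo (suc (suc n)) (λ j → M 0 0 ℤ.* M (suc i) j) y - evalUpTo (suc (suc n)) (λ j → M (suc i) 0 ℤ.* M 0 j) y
          ≈⟨ +-cong (evalUpTo-* (suc (suc n)) (M 0 0) (M (suc i)) y) (-‿cong (evalUpTo-* (suc (suc n)) (M (suc i) 0) (M 0) y)) ⟩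
        φ (M 0 0) * evalUpTo (suc (suc n)) (M (suc i)) y - φ (M (suc i) 0) * evalUpTo (suc (suc n)) (M 0) y
          ≈⟨ +-cong (≈-trans (*-congˡ (rel (suc i))) (zeroʳ _)) (-‿cong (≈-trans (*-congˡ (rel 0)) (zeroʳ _))) ⟩
        0# - 0#                                           ≈⟨ -‿inverseʳ 0# ⟩
        0# ∎)

    -- The Eisenstein shape of the minimal relation of y: all coefficients below y^d are multiples
    -- of p, and the constant one is p itself.
    module _ (b : ℕ → ℤ) (b₀≡1 : b 0 ≡ + 1) (minimal : φ (+ p) * evalUpTo d b y + y ^ d ≈ 0#) where

      up : (ℕ → ℤ) → ℕ → ℤ
      up c zero    = + 0
      up c (suc i) = c i

      -- Multiplication by y, with the overflowing term c_(d′) y^d replaced by - c_(d′) p B(y), B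
      -- having coefficients `b`. Modulo p it is a mere shift.
      y·_ : (ℕ → ℤ) → ℕ → ℤ
      (y· c) i = up c i ℤ.- c d′ ℤ.* + p ℤ.* b i

      y·-relation : ∀ c → IsRelation d c → IsRelation d (y· c)
      y·-relation c rel = begin
        evalUpTo d (y· c) y
          ≈⟨ evalUpTo-- d (up c) (λ i → c d′ ℤ.* + p ℤ.* b i) y ⟩
        (0# + y * E) - evalUpTo d (λ i → c d′ ℤ.* + p ℤ.* b i) y
          ≈⟨ +-congˡ (-‿cong (≈-trans (evalUpTo-* d (c d′ ℤ.* + p) b y) (*-congʳ (*-homo (c d′) (+ p))))) ⟩
        (0# + y * E) - φ (c d′) * φ (+ p) * evalUpTo d b y
          ≈⟨ solve 6 (λ y E e p B q → (con (+ 0) :+ y :* E) :+ :- (e :* p :* B) := y :* (E :+ e :* q) :+ :- (e :* (p :* B :+ y :* q))) ≈-refl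
               y E (φ (c d′)) (φ (+ p)) (evalUpTo d b y) (y ^ d′) ⟩
        y * (E + φ (c d′) * y ^ d′) - φ (c d′) * (φ (+ p) * evalUpTo d b y + y ^ d)
          ≈⟨ +-cong (*-congˡ (≈-trans (≈-sym (evalUpTo-suc d′ c y)) rel)) (-‿cong (*-congˡ minimal)) ⟩
        y * 0# - φ (c d′) * 0#
          ≈⟨ +-cong (zeroʳ y) (-‿cong (zeroʳ _)) ⟩
        0# - 0#
          ≈⟨ -‿inverseʳ 0# ⟩
        0# ∎
        where E = evalUpTo d′ c y

      -- The rows c, y c, y² c, ... are shifts of `c` modulo p, so the matrix is upper triangular
      -- modulo p with c 0 along its diagonal.
      unit-absurd : ∀ c → IsRelation d c → p∤ c 0 → ⊥
      unit-absurd c rel p∤c₀ = triangular-absurd d′ M M-relation lower diag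
        where
        M : ℕ → ℕ → ℤ
        M zero    = c
        M (suc i) = y· M i
        M-relation : ∀ i → IsRelation d (M i)
        M-relation zero    = rel
        M-relation (suc i) = y·-relation (M i) (M-relation i)
        lower : ∀ {i j} → j < i → p∣ M i j
        lower {suc i} {zero}  _         = ℤDiv.∣m∣n⇒∣m-n p∣0 (p∣*p* (M i d′) (b 0))
        lower {suc i} {suc j} (s≤s j<i) = ℤDiv.∣m∣n⇒∣m-n (lower j<i) (p∣*p* (M i d′) (b (suc j)))
        diag : ∀ i → p∤ M i i
        diag zero    = p∤c₀
        diag (suc i) = p∤-- (diag i) (p∣*p* (M i d′) (b (suc i)))

      -- The quotient by y of a relation with constant term e p.
      div-y : (ℕ → ℤ) → ℤ → ℕ → ℤ
      div-y c e i with i ℕ.≟ d′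
      ... | yes _ = ℤ.- e
      ... | no _  = c (suc i) ℤ.- e ℤ.* + p ℤ.* b (suc i)

      div-y-< : ∀ c e {i} → i < d′ → div-y c e i ≡ c (suc i) ℤ.- e ℤ.* + p ℤ.* b (suc i)
      div-y-< c e {i} i<d′ with i ℕ.≟ d′
      ... | yes i≡d′ = contradiction i≡d′ (ℕₚ.<⇒≢ i<d′)
      ... | no _     = refl

      div-y-top : ∀ c e → div-y c e d′ ≡ ℤ.- e
      div-y-top c e with d′ ℕ.≟ d′
      ... | yes _    = refl
      ... | no d′≢d′ = contradiction refl d′≢d′

      -- As b 0 = 1, the minimal relation reads p = - y (p B + y^(d′)). So the constant term e p is
      -- a multiple of y, contributing - e p b (i + 1) below the top and - e at the top; then y is
      -- cancelled.
      div-y-relation : ∀ c e → c 0 ≡ e ℤ.* + p → IsRelation d c → IsRelation d (div-y c e)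
      div-y-relation c e c₀≡ep rel = *-cancelˡ-0 y≉0 (begin
        y * evalUpTo d (div-y c e) y
          ≈⟨ *-congˡ (evalUpTo-suc d′ (div-y c e) y) ⟩
        y * (evalUpTo d′ (div-y c e) y + φ (div-y c e d′) * y ^ d′)
          ≈⟨ *-congˡ (+-cong (evalUpTo-cong d′ y (λ i i<d′ → div-y-< c e i<d′)) (*-congʳ (≈-trans (reflexive (cong φ (div-y-top c e))) (-‿homo e)))) ⟩
        y * (evalUpTo d′ (λ i → c (suc i) ℤ.- e ℤ.* + p ℤ.* b (suc i)) y + (- φ e) * y ^ d′)
          ≈⟨ *-congˡ (+-congʳ (≈-trans (evalUpTo-- d′ _ _ y) (+-congˡ (-‿cong (≈-trans (evalUpTo-* d′ (e ℤ.* + p) _ y) (*-congʳ (*-homo e (+ p)))))))) ⟩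
        y * ((E - φ e * φ (+ p) * B) + (- φ e) * y ^ d′)
          ≈⟨ solve 6 (λ y E e p B q → y :* ((E :+ :- (e :* p :* B)) :+ (:- e) :* q) :=
                (e :* p :+ y :* E) :+ :- (e :* (p :* (con (+ 1) :+ y :* B) :+ y :* q))) ≈-refl y E (φ e) (φ (+ p)) B (y ^ d′) ⟩
        (φ e * φ (+ p) + y * E) - φ e * (φ (+ p) * (φ (+ 1) + y * B) + y ^ d)
          ≈⟨ +-cong (≈-trans (+-congʳ (≈-trans (≈-sym (*-homo e (+ p))) (reflexive (cong φ (sym c₀≡ep))))) rel)
               (-‿cong (*-congˡ (≈-trans (+-congʳ (*-congˡ (+-congʳ (reflexive (cong φ (sym b₀≡1)))))) minimal))) ⟩
        0# - φ e * 0#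
          ≈⟨ +-congˡ (-‿cong (zeroʳ _)) ⟩
        0# - 0#
          ≈⟨ -‿inverseʳ 0# ⟩
        0# ∎)
        where
        E = evalUpTo d′ (λ i → c (suc i)) y
        B = evalUpTo d′ (λ i → b (suc i)) y

      -- Below the top index, `div-y` is a left shift modulo p. Repeating it moves the first
      -- coefficient prime to p into the constant position, where `unit-absurd` applies.
      first-nonmultiple-absurd : ∀ i c → i < d → IsRelation d c → (∀ {j} → j < i → p∣ c j) → p∤ c i → ⊥
      first-nonmultiple-absurd zero    c _   rel _     p∤c₀ = unit-absurd c rel p∤c₀
      first-nonmultiple-absurd (suc i) c (s≤s i<d′) rel below p∤cᵢ with ℤDiv.divides e c₀≡ep ← below (s≤s z≤n) =
        first-nonmultiple-absurd i (div-y c e) (ℕₚ.m≤n⇒m≤1+n i<d′) (div-y-relation c e c₀≡ep rel)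
          (λ {j} j<i → subst p∣_ (sym (div-y-< c e (ℕₚ.<-trans j<i i<d′))) (ℤDiv.∣m∣n⇒∣m-n (below (s≤s j<i)) (p∣*p* e (b (suc j)))))
          (subst p∤_ (sym (div-y-< c e i<d′)) (p∤-- p∤cᵢ (p∣*p* e (b (suc i)))))

      relation⇒p∣ : ∀ c → IsRelation d c → ∀ n → n ≤ d → ∀ {j} → j < n → p∣ c j
      relation⇒p∣ c rel (suc n) n<d {j} (s≤s j≤n) with ℕₚ.m≤n⇒m<n∨m≡n j≤n
      ... | inj₁ j<n = relation⇒p∣ c rel n (ℕₚ.<⇒≤ n<d) j<n
      ... | inj₂ refl with + p ℤDiv.∣? c j
      ...   | yes p∣cⱼ = p∣cⱼ
      ...   | no  p∤cⱼ = ⊥-elim (first-nonmultiple-absurd j c n<d rel (relation⇒p∣ c rel j (ℕₚ.<⇒≤ n<d)) p∤cⱼ)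

      relation-div-p : ∀ c → IsRelation d c → ∃ λ c′ → IsRelation d c′ × (∀ {i} → i < d → c i ≡ + p ℤ.* c′ i)
      relation-div-p c rel = c′ , *-cancelˡ-0 (charZero (suc d′)) rel′ , c≡pc′
        where
        p∣c : ∀ {i} → i < d → p∣ c i
        p∣c = relation⇒p∣ c rel d ℕₚ.≤-refl
        c′ : ℕ → ℤ
        c′ i with i ℕ.<? d
        ... | yes i<d = ℤDiv._∣_.quotient (p∣c i<d)
        -- A default value: a relation of length `d` reads only the entries below `d`.
        ... | no _    = + 0
        c≡pc′ : ∀ {i} → i < d → c i ≡ + p ℤ.* c′ i
        c≡pc′ {i} i<d with i ℕ.<? d
        ... | yes i<d = trans (ℤDiv._∣_.equality (p∣c i<d)) (ℤₚ.*-comm _ (+ p))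
        ... | no i≮d  = contradiction i<d i≮d
        rel′ : φ (+ p) * evalUpTo d c′ y ≈ 0#
        rel′ = begin
          φ (+ p) * evalUpTo d c′ y             ≈⟨ evalUpTo-* d (+ p) c′ y ⟨
          evalUpTo d (λ i → + p ℤ.* c′ i) y     ≈⟨ evalUpTo-cong d y (λ i i<d → c≡pc′ i<d) ⟨
          evalUpTo d c y                        ≈⟨ rel ⟩
          0#                                    ∎

      -- Infinite descent: dividing the whole relation by p gives another relation, with strictly
      -- smaller absolute value at every nonzero coefficient. The bound `n` drives the recursion.
      independent-bounded : ∀ n c → IsRelation d c → ∀ {i} → i < d → ∣ c i ∣ ≤ n → c i ≡ + 0
      independent-bounded zero    c rel     i<d ∣c∣≤0 = ℤₚ.∣i∣≡0⇒i≡0 (ℕₚ.n≤0⇒n≡0 ∣c∣≤0)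
      independent-bounded (suc n) c rel {i} i<d ∣c∣≤n with c′ , rel′ , c≡pc′ ← relation-div-p c rel =
        trans (c≡pc′ i<d) (trans (cong (+ p ℤ.*_) (independent-bounded n c′ rel′ i<d
          (smaller ∣ c′ i ∣ (ℕₚ.≤-trans (ℕₚ.≤-reflexive (sym (trans (cong ∣_∣ (c≡pc′ i<d)) (ℤₚ.abs-* (+ p) (c′ i))))) ∣c∣≤n))))
          (ℤₚ.*-zeroʳ (+ p)))
        where
        smaller : ∀ a → p ℕ.* a ≤ suc n → a ≤ n
        smaller zero    _       = z≤n
        smaller (suc a) pa≤1+n = ℕₚ.≤-pred (ℕₚ.<-≤-trans (subst (suc a <_) (ℕₚ.*-comm (suc a) p) (ℕₚ.m<m*n (suc a) p (s≤s (s≤s z≤n)))) pa≤1+n)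

      independent : ∀ c → IsRelation d c → ∀ {i} → i < d → c i ≡ + 0
      independent c rel {i} i<d = independent-bounded ∣ c i ∣ c rel i<d ℕₚ.≤-refl

coeff-translate-vanish : ∀ P d → (∀ i → d ≤ i → coeff P i ≡ + 0) → ∀ i → d ≤ i → coeff (translate P) i ≡ + 0
coeff-translate-vanish []      d h i d≤i = refl
coeff-translate-vanish (c ∷ P) d h i d≤i = trans (coeff-⊕ (c ∷ []) ([1+z]⊗ T) i)
  (trans (cong (λ t → coeff (c ∷ []) i ℤ.+ t) (coeff-⊕ T (+ 0 ∷ T) i)) (sum d i h d≤i))
  where
  T = translate P
  sum : ∀ d i → (∀ i → d ≤ i → coeff (c ∷ P) i ≡ + 0) → d ≤ i → coeff (c ∷ []) i ℤ.+ (coeff T i ℤ.+ coeff (+ 0 ∷ T) i) ≡ + 0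
  sum zero    zero    h _ = cong₂ (λ a b → a ℤ.+ (b ℤ.+ + 0)) (h 0 z≤n) (coeff-translate-vanish P 0 (λ i _ → h (suc i) z≤n) 0 z≤n)
  sum zero    (suc i) h _ = cong₂ (λ a b → + 0 ℤ.+ (a ℤ.+ b)) (T≡0 (suc i)) (T≡0 i)
    where T≡0 = λ i → coeff-translate-vanish P 0 (λ i _ → h (suc i) z≤n) i z≤n
  sum (suc d) (suc i) h (s≤s d≤i) = cong₂ (λ a b → + 0 ℤ.+ (a ℤ.+ b)) (T≡0 (suc i) (ℕₚ.m≤n⇒m≤1+n d≤i)) (T≡0 i d≤i)
    where T≡0 = coeff-translate-vanish P d (λ i d≤i → h (suc i) (s≤s d≤i))

-- The minimal relation of ζ - 1 and its consequences for ζ.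

module Cyclotomic {c ℓ} (F : CharZeroField c ℓ) (d′ : ℕ) (p-prime : Prime (2 ℕ.+ d′))
  (ζ : CharZeroField.Carrier F) (ζ-primitive : CharZeroField.IsPrimitiveRoot F (2 ℕ.+ d′) ζ) where
  open CharZeroField F hiding (_/_) renaming (_×_ to _×ᶠ_; refl to ≈-refl; sym to ≈-sym; trans to ≈-trans)
  open FieldProperties F
  open Evaluation commutativeRing fromℤ-hom
  open import Algebra.Properties.Ring (CommutativeRing.ring commutativeRing) using (x∙y⁻¹≈ε⇒x≈y)
  open import Algebra.Properties.Semiring.Exp semiring using (^-congˡ)
  open import Relation.Binary.Reasoning.Setoid setoid

  y : Carrier
  y = ζ - 1#

  open Independence F d′ p-prime y using (p; d; IsRelation; independent)

  y≉0 : ¬ (y ≈ 0#)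
  y≉0 y≈0 = proj₂ ζ-primitive 1 (s≤s z≤n) (s≤s (s≤s z≤n)) (≈-trans (*-identityʳ ζ) (x∙y⁻¹≈ε⇒x≈y ζ 1# y≈0))

  1+y≈ζ : 1# + y ≈ ζ
  1+y≈ζ = begin
    1# + (ζ - 1#)      ≈⟨ +-comm _ _ ⟩
    ζ - 1# + 1#        ≈⟨ +-assoc _ _ _ ⟩
    ζ + (- 1# + 1#)    ≈⟨ +-congˡ (-‿inverseˡ 1#) ⟩
    ζ + 0#             ≈⟨ +-identityʳ ζ ⟩
    ζ                  ∎

  eval-binomial : ∀ n x → eval (binomial n) x ≈ (1# + x) ^ n
  eval-binomial zero    x = ≈-trans (eval-const (+ 1) x) 1-homo
  eval-binomial (suc n) x = ≈-trans (eval-[1+z]⊗ (binomial n) x) (*-congˡ (eval-binomial n x))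

  -- C(p, i + 1) / p. The division is exact for i < d, where C(p, i + 1) lies strictly inside its
  -- row.
  b : ℕ → ℤ
  b i = + ((p C suc i) ℕDivMod./ p)

  p*b≡C : ∀ {i} → i < d → + p ℤ.* b i ≡ + (p C suc i)
  p*b≡C {i} i<d = trans (sym (ℤₚ.pos-* p ((p C suc i) ℕDivMod./ p))) (cong +_ (ℕDivMod.m*[n/m]≡n (prime∣C p-prime (s≤s z≤n) (s≤s i<d))))

  b₀≡1 : b 0 ≡ + 1
  b₀≡1 = cong +_ (trans (cong (ℕDivMod._/ p) (nC1≡n p)) (ℕDivMod.n/n≡1 p))

  -- Times y, the left side is the binomial expansion of (1 + y)^p without its constant term, hence
  -- ζ^p - 1 = 0. The two unit coefficients C(p, 0) and C(p, p) are split off separately.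
  minimal : fromℤ (+ p) * evalUpTo d b y + y ^ d ≈ 0#
  minimal = *-cancelˡ-0 y≉0 (begin
    y * (fromℤ (+ p) * evalUpTo d b y + y ^ d)
      ≈⟨ *-congˡ (+-congʳ (evalUpTo-* d (+ p) b y)) ⟨
    y * (evalUpTo d (λ i → + p ℤ.* b i) y + y ^ d)
      ≈⟨ *-congˡ (+-cong (evalUpTo-cong d y (λ i i<d → trans (p*b≡C i<d) (sym (coeff-binomial p (suc i)))))
           (≈-trans (≈-sym (*-identityˡ _)) (*-congʳ (≈-sym top)))) ⟩
    y * (evalUpTo d choose y + fromℤ (choose d) * y ^ d)
      ≈⟨ *-congˡ (evalUpTo-suc d choose y) ⟨
    y * evalUpTo p choose y
      ≈⟨ solve 2 (λ a e → e := a :+ e :+ :- a) ≈-refl (fromℤ (coeff (binomial p) 0)) (y * evalUpTo p choose y) ⟩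
    evalUpTo (suc p) (coeff (binomial p)) y - fromℤ (coeff (binomial p) 0)
      ≈⟨ +-cong (≈-sym (eval≈evalUpTo (binomial p) (suc p) y (λ i p<i → trans (coeff-binomial p i) (cong +_ (k>n⇒nCk≡0 p<i)))))
           (-‿cong (≈-trans (reflexive (cong fromℤ (coeff-binomial p 0))) 1-homo)) ⟩
    eval (binomial p) y - 1#
      ≈⟨ +-congʳ (≈-trans (eval-binomial p y) (≈-trans (^-congˡ p 1+y≈ζ) (proj₁ ζ-primitive))) ⟩
    1# - 1#
      ≈⟨ -‿inverseʳ 1# ⟩
    0# ∎)
    where
    choose : ℕ → ℤ
    choose i = coeff (binomial p) (suc i)
    top : fromℤ (choose d) ≈ 1#
    top = ≈-trans (reflexive (cong fromℤ (trans (coeff-binomial p p) (cong +_ (nCn≡1 p))))) 1-homo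

  root⇒zero : ∀ P → (∀ i → d ≤ i → coeff P i ≡ + 0) → eval P ζ ≈ 0# → ∀ x → P at x ≡ + 0
  -- The sample point 2 + x is 1 + (1 + x), so the value of `P` there is that of its translate at 1
  -- + x.
  root⇒zero P P-vanish Pζ≈0 x = trans (sym (evalℤ-translate P (+ (1 ℕ.+ x)))) (evalℤ-zero T (+ (1 ℕ.+ x)) T≡0)
    where
    T = translate P
    T-vanish : ∀ i → d ≤ i → coeff T i ≡ + 0
    T-vanish = coeff-translate-vanish P d P-vanish
    relation : IsRelation d (coeff T)
    relation = begin
      evalUpTo d (coeff T) y    ≈⟨ eval≈evalUpTo T d y T-vanish ⟨
      eval T y                  ≈⟨ eval-translate P y ⟩
      eval P (1# + y)           ≈⟨ eval-cong P 1+y≈ζ ⟩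
      eval P ζ                  ≈⟨ Pζ≈0 ⟩
      0#                        ∎
    T≡0 : ∀ i → coeff T i ≡ + 0
    T≡0 i with ℕₚ.<-≤-connex i d
    ... | inj₁ i<d = independent y≉0 b b₀≡1 minimal (coeff T) relation i<d
    ... | inj₂ d≤i = T-vanish i d≤i

  ζ^≉1 : ∀ n → ¬ (p ∣ n) → ¬ (ζ ^ n ≈ 1#)
  ζ^≉1 n p∤n ζⁿ≈1 = proj₂ ζ-primitive (n ℕDivMod.% p) (ℕₚ.n≢0⇒n>0 (λ n%p≡0 → p∤n (ℕDiv.m%n≡0⇒n∣m n p n%p≡0))) (ℕDivMod.m%n<n n p) (begin
    ζ ^ (n ℕDivMod.% p)                              ≈⟨ *-identityʳ _ ⟨
    ζ ^ (n ℕDivMod.% p) * 1#                         ≈⟨ *-congˡ (1^ (n ℕDivMod./ p)) ⟨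
    ζ ^ (n ℕDivMod.% p) * 1# ^ (n ℕDivMod./ p)       ≈⟨ *-congˡ (^-congˡ (n ℕDivMod./ p) (proj₁ ζ-primitive)) ⟨
    ζ ^ (n ℕDivMod.% p) * (ζ ^ p) ^ (n ℕDivMod./ p)  ≈⟨ *-congˡ (^-assocʳ ζ p (n ℕDivMod./ p)) ⟩
    ζ ^ (n ℕDivMod.% p) * ζ ^ (p ℕ.* (n ℕDivMod./ p)) ≈⟨ ^-homo-* ζ (n ℕDivMod.% p) _ ⟨
    ζ ^ (n ℕDivMod.% p ℕ.+ p ℕ.* (n ℕDivMod./ p))    ≡⟨ cong (λ t → ζ ^ (n ℕDivMod.% p ℕ.+ t)) (ℕₚ.*-comm p (n ℕDivMod./ p)) ⟩
    ζ ^ (n ℕDivMod.% p ℕ.+ n ℕDivMod./ p ℕ.* p)      ≡⟨ cong (ζ ^_) (ℕDivMod.m≡m%n+[m/n]*n n p) ⟨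
    ζ ^ n                                            ≈⟨ ζⁿ≈1 ⟩
    1#                                               ∎)
    where
    open import Algebra.Properties.Semiring.Exp semiring using (^-assocʳ; ^-homo-*)
    1^ : ∀ m → 1# ^ m ≈ 1#
    1^ zero    = ≈-refl
    1^ (suc m) = ≈-trans (*-identityˡ _) (1^ m)

-- Comparison of the degree with the number of distinct fractions.

count≤length : ∀ {A : Set} (f : ℕ → Bool) (g : ℕ → A) → (∀ {i j} → g i ≡ g j → i ≡ j) → ∀ n (ys : List A) →
  (∀ {i} → i < n → f i ≡ true → g i ∈ ys) → count f n ≤ length ys
count≤length f g g-inj zero    ys _ = z≤n
count≤length f g g-inj (suc n) ys h with f n in fn
... | false = count≤length f g g-inj n ys (λ i<n → h (ℕₚ.m≤n⇒m≤1+n i<n))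
-- One occurrence of `g n` is taken out of the list; by injectivity the images of smaller indices
-- survive in the rest.
... | true with xs , zs , refl ← ∈-∃++ (h ℕₚ.≤-refl fn) = ℕₚ.≤-trans
  (s≤s (count≤length f g g-inj n (xs ++ zs) (λ i<n fi → avoid (ℕₚ.<⇒≢ i<n) (∈-++⁻ xs (h (ℕₚ.m≤n⇒m≤1+n i<n) fi)))))
  (ℕₚ.≤-reflexive (sym (trans (Listₚ.length-++ xs) (trans (ℕₚ.+-suc (length xs) (length zs)) (cong suc (sym (Listₚ.length-++ xs)))))))
  where
  avoid : ∀ {i} → i ≢ n → g i ∈ xs ⊎ g i ∈ [ g n ] ++ zs → g i ∈ xs ++ zs
  avoid i≢n (inj₁ i∈xs)         = ∈-++⁺ˡ i∈xs
  avoid i≢n (inj₂ (here gi≡gn)) = contradiction (g-inj gi≡gn) i≢n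
  avoid i≢n (inj₂ (there i∈zs)) = ∈-++⁺ʳ xs i∈zs

hits⇒∣ : ∀ {k} N (ns : Fin k → ℕ) r → hits N ns r ≡ true → ∃ λ s → N ∣ r ℕ.* ns s
hits⇒∣ {suc k} N ns r eq with N ∣? r ℕ.* ns zero
... | yes d = zero , d
... | no _ with s , d ← hits⇒∣ N (ns ∘ suc) r eq = suc s , d

-- If r n = t N then r / N = t / n, and r < N forces t < n.
fraction∈fracs : ∀ N-1 n .{{_ : NonZero n}} r → r < suc N-1 → suc N-1 ∣ r ℕ.* n → (+ r) ℚ./ suc N-1 ∈ fracs n
fraction∈fracs N-1 n@(suc n-1) r r<N (divides t rn≡tN) = subst (_∈ fracs n) (sym r/N≡t/n) (∈-map⁺ (λ t → (+ t) ℚ./ n) (∈-upTo⁺ t<n))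
  where
  r/N≡t/n : (+ r) ℚ./ suc N-1 ≡ (+ t) ℚ./ n
  r/N≡t/n = ℚₚ.fromℚᵘ-cong {mkℚᵘ (+ r) N-1} {mkℚᵘ (+ t) n-1} (*≡* (trans (sym (ℤₚ.pos-* r n)) (trans (cong +_ rn≡tN) (ℤₚ.pos-* t (suc N-1)))))
  t<n : t < n
  t<n = ℕₚ.*-cancelʳ-< (suc N-1) t n (subst (_< n ℕ.* suc N-1) rn≡tN (subst (r ℕ.* n <_) (ℕₚ.*-comm (suc N-1) n) (ℕₚ.*-monoˡ-< n r<N)))

-- Distinct numerators over the common denominator N are distinct fractions of `S`. This inequality
-- is what bounds the degree of the lcm below p.
count-hits≤cardS : ∀ k (n : Fin k → ℤ) → (∀ s → NonZero ∣ n s ∣) → ∀ N .{{_ : NonZero N}} →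
  count (hits N (λ s → ∣ n s ∣)) N ≤ cardS k n
count-hits≤cardS k n pos N@(suc N-1) = count≤length (hits N (λ s → ∣ n s ∣)) (λ r → (+ r) ℚ./ N) injective N (S k n) member
  where
  injective : ∀ {i j} → (+ i) ℚ./ N ≡ (+ j) ℚ./ N → i ≡ j
  injective {i} {j} eq with *≡* i*N≡j*N ← ℚₚ./-injective-≃ (mkℚᵘ (+ i) N-1) (mkℚᵘ (+ j) N-1) eq =
    ℤₚ.+-injective (ℤₚ.*-cancelʳ-≡ (+ i) (+ j) (+ N) i*N≡j*N)
  member : ∀ {r} → r < N → hits N (λ s → ∣ n s ∣) r ≡ true → (+ r) ℚ./ N ∈ S k n
  member {r} r<N hit with s , N∣rn ← hits⇒∣ N (λ s → ∣ n s ∣) r hit =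
    ∈-deduplicate⁺ ℚ._≟_ (∈-concatMap⁺ (λ s → fracs ∣ n s ∣) (lose (∈-allFin s) (fraction∈fracs N-1 ∣ n s ∣ {{pos s}} r r<N N∣rn)))

-- The sum over a common denominator, and the generating polynomial of w.

open import Algebra.Properties.Semiring.Exp (CommutativeRing.semiring ℤₚ.+-*-commutativeRing) using () renaming (_^_ to _^ᶻ_)

indicatorℤ : Bool → ℤ
indicatorℤ b = if b then + 1 else + 0

coeff-geometric : ∀ n .{{_ : NonZero n}} h i → i < h ℕ.* n → coeff (geometric n h) i ≡ indicatorℤ (does (n ∣? i))
coeff-geometric n@(suc n-1) (suc h) i i<hn with ℕₚ.<-≤-connex i n
... | inj₁ i<n = trans (coeff-⊕ (+ 1 ∷ []) (shift n (geometric n h)) i)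
        (trans (cong (λ t → coeff (+ 1 ∷ []) i ℤ.+ t) (coeff-shift-< n (geometric n h) i<n)) (initial i i<n))
  where
  initial : ∀ i → i < n → coeff (+ 1 ∷ []) i ℤ.+ + 0 ≡ indicatorℤ (does (n ∣? i))
  initial zero    _   = sym (cong indicatorℤ (dec-true (n ∣? 0) (n ℕDiv.∣0)))
  initial (suc i) i<n = sym (cong indicatorℤ (dec-false (n ∣? suc i) (ℕDiv.>⇒∤ i<n)))
... | inj₂ n≤i with j , refl ← ℕₚ.m≤n⇒∃[o]m+o≡n n≤i = begin
  coeff ((+ 1 ∷ []) ⊕ shift n (geometric n h)) (n ℕ.+ j)  ≡⟨ coeff-⊕ (+ 1 ∷ []) (shift n (geometric n h)) (n ℕ.+ j) ⟩
  + 0 ℤ.+ coeff (shift n (geometric n h)) (n ℕ.+ j)       ≡⟨ ℤₚ.+-identityˡ _ ⟩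
  coeff (shift n (geometric n h)) (n ℕ.+ j)               ≡⟨ coeff-shift-+ n (geometric n h) j ⟩
  coeff (geometric n h) j                                 ≡⟨ coeff-geometric n h j (ℕₚ.+-cancelˡ-< n j (h ℕ.* n) i<hn) ⟩
  indicatorℤ (does (n ∣? j))                              ≡⟨ cong indicatorℤ (does-⇔
         (mk⇔ (ℕDiv.∣m∣n⇒∣m+n ℕDiv.∣-refl) (λ d → ℕDiv.∣m+n∣m⇒∣n d ℕDiv.∣-refl))
         (n ∣? j) (n ∣? n ℕ.+ j)) ⟩
  indicatorℤ (does (n ∣? n ℕ.+ j))                        ∎
  where open ≡-Reasoning

-- Below N = h n, the polynomial z^a (z^N - 1) / (zⁿ - 1) is the indicator of the residue class of
-- a. Here a < n enters: for i < a the coefficient is 0, and 0 < a - i < n keeps n from dividing.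
coeff-shift-geometric : ∀ n .{{_ : NonZero n}} h a i → a < n → i < h ℕ.* n →
  coeff (shift a (geometric n h)) i ≡ indicatorℤ (does (n ∣? ∣ + i ℤ.- + a ∣))
coeff-shift-geometric n h a i a<n i<hn with ℕₚ.<-≤-connex i a
... | inj₁ i<a = trans (coeff-shift-< a (geometric n h) i<a) (sym (cong indicatorℤ (dec-false (n ∣? ∣ + i ℤ.- + a ∣)
        (λ d → ℕDiv.>⇒∤ {{ℕ.>-nonZero (ℕₚ.m<n⇒0<n∸m i<a)}} (ℕₚ.≤-<-trans (ℕₚ.m∸n≤m a i) a<n) (subst (n ∣_) distance d)))))
  where
  distance : ∣ + i ℤ.- + a ∣ ≡ a ℕ.∸ i
  distance = trans (cong ∣_∣ (ℤₚ.m-n≡m⊖n i a)) (ℤₚ.∣⊖∣-< i<a)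
... | inj₂ a≤i with j , refl ← ℕₚ.m≤n⇒∃[o]m+o≡n a≤i =
  trans (coeff-shift-+ a (geometric n h) j)
    (trans (coeff-geometric n h j (ℕₚ.≤-<-trans (ℕₚ.m≤n+m j a) i<hn)) (cong (λ t → indicatorℤ (does (n ∣? t))) (sym distance)))
  where
  distance : ∣ + (a ℕ.+ j) ℤ.- + a ∣ ≡ j
  distance = cong ∣_∣ (trans (cong (ℤ._- + a) (ℤₚ.+-comm (+ a) (+ j)))
    (trans (ℤₚ.+-assoc (+ j) (+ a) (ℤ.- (+ a)))
    (trans (cong (λ t → + j ℤ.+ t) (ℤₚ.+-inverseʳ (+ a))) (ℤₚ.+-identityʳ (+ j)))))

abs-< : ∀ {i j} → + 0 ℤ.≤ i → i ℤ.< j → ∣ i ∣ < ∣ j ∣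
abs-< {+ _} {+ _} _ (ℤ.+<+ i<j) = i<j

-- 1/(1 - zⁿ) is never formed: with a common multiple D = Q s · (z^(n s) - 1) as denominator,
-- Σ λ_s z^(a s)/(1 - z^(n s)) is - numerator / D.
module Numerators {k} (lam a n : Fin k → ℤ) (0≤a : ∀ s → + 0 ℤ.≤ a s) (a<n : ∀ s → a s ℤ.< n s) where
  as ns : Fin k → ℕ
  as s = ∣ a s ∣
  ns s = ∣ n s ∣

  as<ns : ∀ s → as s < ns s
  as<ns s = abs-< (0≤a s) (a<n s)

  ns-nonZero : ∀ s → NonZero (ns s)
  ns-nonZero s = ℕ.>-nonZero (ℕₚ.≤-<-trans z≤n (as<ns s))

  a≡+as : ∀ s → a s ≡ + as s
  a≡+as s = sym (ℤₚ.0≤i⇒+∣i∣≡i (0≤a s))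

  numerator : (Fin k → Poly) → List (Fin k) → Poly
  numerator Q []       = []
  numerator Q (s ∷ ss) = lam s · shift (as s) (Q s) ⊕ numerator Q ss

  Cofactors : Poly → (Fin k → Poly) → Set
  Cofactors D Q = ∀ s x → D at x ≡ Q s at x ℤ.* (zⁿ-1 (ns s)) at x

  at-numerator-∷ : ∀ Q s ss x → numerator Q (s ∷ ss) at x ≡ lam s ℤ.* (pt x ^ᶻ as s ℤ.* Q s at x) ℤ.+ numerator Q ss at x
  at-numerator-∷ Q s ss x = trans (at-⊕ (lam s · shift (as s) (Q s)) (numerator Q ss) x)
    (cong (ℤ._+ numerator Q ss at x) (trans (at-· (lam s) (shift (as s) (Q s)) x) (cong (lam s ℤ.*_) (at-shift (as s) (Q s) x))))

  -- Two numerators of one fraction, compared by cross-multiplication. Term by term, D Q′ = Q (zⁿ -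
  -- 1) Q′ = D′ Q.
  numerator-cross : ∀ {D Q D′ Q′} → Cofactors D Q → Cofactors D′ Q′ →
    ∀ ss x → D at x ℤ.* numerator Q′ ss at x ≡ D′ at x ℤ.* numerator Q ss at x
  numerator-cross {D} {Q} {D′} {Q′} DQ D′Q′ []       x = trans (ℤₚ.*-zeroʳ (D at x)) (sym (ℤₚ.*-zeroʳ (D′ at x)))
  numerator-cross {D} {Q} {D′} {Q′} DQ D′Q′ (s ∷ ss) x = begin
    D at x ℤ.* numerator Q′ (s ∷ ss) at x
      ≡⟨ cong (D at x ℤ.*_) (at-numerator-∷ Q′ s ss x) ⟩
    D at x ℤ.* (lam s ℤ.* (Z ℤ.* Q′ s at x) ℤ.+ numerator Q′ ss at x)
      ≡⟨ distribute (D at x) (lam s) Z (Q′ s at x) (numerator Q′ ss at x) ⟩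
    D at x ℤ.* Q′ s at x ℤ.* (lam s ℤ.* Z) ℤ.+ D at x ℤ.* numerator Q′ ss at x
      ≡⟨ cong₂ (λ t u → t ℤ.* (lam s ℤ.* Z) ℤ.+ u) DQ′≡D′Q (numerator-cross {D} {Q} {D′} {Q′} DQ D′Q′ ss x) ⟩
    D′ at x ℤ.* Q s at x ℤ.* (lam s ℤ.* Z) ℤ.+ D′ at x ℤ.* numerator Q ss at x
      ≡⟨ distribute (D′ at x) (lam s) Z (Q s at x) (numerator Q ss at x) ⟨
    D′ at x ℤ.* (lam s ℤ.* (Z ℤ.* Q s at x) ℤ.+ numerator Q ss at x)
      ≡⟨ cong (D′ at x ℤ.*_) (at-numerator-∷ Q s ss x) ⟨
    D′ at x ℤ.* numerator Q (s ∷ ss) at x ∎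
    where
    open ≡-Reasoning
    Z = pt x ^ᶻ as s
    distribute : ∀ d l z q t → d ℤ.* (l ℤ.* (z ℤ.* q) ℤ.+ t) ≡ d ℤ.* q ℤ.* (l ℤ.* z) ℤ.+ d ℤ.* t
    distribute = solve-∀
    rotate : ∀ q r t → q ℤ.* r ℤ.* t ≡ t ℤ.* r ℤ.* q
    rotate = solve-∀
    DQ′≡D′Q : D at x ℤ.* Q′ s at x ≡ D′ at x ℤ.* Q s at x
    DQ′≡D′Q = trans (cong (ℤ._* Q′ s at x) (DQ s x)) (trans (rotate (Q s at x) _ (Q′ s at x)) (cong (ℤ._* Q s at x) (sym (D′Q′ s x))))

  cofactor-monic : ∀ {D Q m} → Monic m D → Cofactors D Q → ∀ s → ∃ λ e → ns s ℕ.+ e ≡ m × Monic e (Q s)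
  cofactor-monic {D} {Q} {m} monicD DQ s = Monic-cancelˡ (zⁿ-1 (ns s)) (Q s) (Monic-zⁿ-1 (ns s) {{ns-nonZero s}})
    (Monic-resp D (zⁿ-1 (ns s) ⊗ Q s) (λ x → trans (DQ s x) (trans (ℤₚ.*-comm (Q s at x) _) (sym (at-⊗ (zⁿ-1 (ns s)) (Q s) x)))) monicD)

  -- Q s has degree m - n s, so z^(a s) Q s has degree a s + m - n s < m: the fraction is proper.
  numerator-vanish : ∀ {D Q m} → Monic m D → Cofactors D Q → ∀ ss i → m ≤ i → coeff (numerator Q ss) i ≡ + 0
  numerator-vanish                 monicD DQ []       i m≤i = refl
  numerator-vanish {D} {Q} {m} monicD DQ (s ∷ ss) i m≤i with e , n+e≡m , monicQ ← cofactor-monic {D} {Q} {m} monicD DQ s = begin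
    coeff (numerator Q (s ∷ ss)) i
      ≡⟨ coeff-⊕ (lam s · shift (as s) (Q s)) (numerator Q ss) i ⟩
    coeff (lam s · shift (as s) (Q s)) i ℤ.+ coeff (numerator Q ss) i
      ≡⟨ cong₂ ℤ._+_ (coeff-· (lam s) (shift (as s) (Q s)) i) (numerator-vanish {D} {Q} {m} monicD DQ ss i m≤i) ⟩
    lam s ℤ.* coeff (shift (as s) (Q s)) i ℤ.+ + 0
      ≡⟨ ℤₚ.+-identityʳ _ ⟩
    lam s ℤ.* coeff (shift (as s) (Q s)) i
      ≡⟨ cong (lam s ℤ.*_) (proj₂ (Monic-shift (as s) (Q s) {e} monicQ) i a+e<i) ⟩
    lam s ℤ.* + 0
      ≡⟨ ℤₚ.*-zeroʳ (lam s) ⟩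
    + 0 ∎
    where
    open ≡-Reasoning
    a+e<i : as s ℕ.+ e < i
    a+e<i = ℕₚ.<-≤-trans (ℕₚ.<-≤-trans (ℕₚ.+-monoˡ-< e (as<ns s)) (ℕₚ.≤-reflexive n+e≡m)) m≤i

  -- Any common multiple would serve as a period; for the product, p ∤ N follows from Euclid's
  -- lemma.
  N : ℕ
  N = Vector.foldr ℕ._*_ 1 ns

  private
    factor∣product : ∀ {k} (ms : Fin k → ℕ) s → ms s ∣ Vector.foldr ℕ._*_ 1 ms
    factor∣product ms zero    = ℕDiv.m∣m*n _
    factor∣product ms (suc s) = ℕDiv.∣-trans (factor∣product (ms ∘ suc) s) (ℕDiv.n∣m*n (ms zero))

    product-nonZero : ∀ {k} (ms : Fin k → ℕ) → (∀ s → NonZero (ms s)) → NonZero (Vector.foldr ℕ._*_ 1 ms)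
    product-nonZero {zero}  ms pos = _
    product-nonZero {suc k} ms pos = ℕₚ.m*n≢0 (ms zero) _ {{pos zero}} {{product-nonZero (ms ∘ suc) (pos ∘ suc)}}

    prime∤product : ∀ {k p} (ms : Fin k → ℕ) → Prime p → (∀ s → ¬ (p ∣ ms s)) → 1 < p → ¬ (p ∣ Vector.foldr ℕ._*_ 1 ms)
    prime∤product {zero}  ms p-prime p∤ 1<p p∣1 = ℕDiv.>⇒∤ 1<p p∣1
    prime∤product {suc k} ms p-prime p∤ 1<p p∣m = [ p∤ zero , prime∤product (ms ∘ suc) p-prime (p∤ ∘ suc) 1<p ]′
      (euclidsLemma (ms zero) (Vector.foldr ℕ._*_ 1 (ms ∘ suc)) p-prime p∣m)

  ns∣N : ∀ s → ns s ∣ N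
  ns∣N = factor∣product ns

  instance
    N-nonZero : NonZero N
    N-nonZero = product-nonZero ns ns-nonZero

  p∤N : ∀ {p} → Prime p → 1 < p → (∀ s → ns s < p) → ¬ (p ∣ N)
  p∤N p-prime 1<p ns<p = prime∤product ns p-prime (λ s → ℕDiv.>⇒∤ {{ns-nonZero s}} (ns<p s)) 1<p

  N/n : Fin k → ℕ
  N/n s = ℕDiv._∣_.quotient (ns∣N s)

  -- The cofactors (z^N - 1) / (z^(n s) - 1), explicit so that the coefficients of the numerator
  -- over z^N - 1 can be read off.
  blocks : Fin k → Poly
  blocks s = geometric (ns s) (N/n s)

  blocks-cofactors : Cofactors (zⁿ-1 N) blocks
  blocks-cofactors s x = trans (cong (λ m → (zⁿ-1 m) at x) (ℕDiv._∣_.equality (ns∣N s))) (at-geometric (ns s) (N/n s) x)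

  W : Poly
  W = numerator blocks (allFin k)

  hit? : ∀ x s → Dec (ns s ∣ ∣ x ℤ.- a s ∣)
  hit? x s = ns s ∣? ∣ x ℤ.- a s ∣

  coeff-numerator-blocks : ∀ i → i < N → ∀ ss → coeff (numerator blocks ss) i ≡ foldr ℤ._+_ (+ 0) (map lam (filter (hit? (+ i)) ss))
  coeff-numerator-blocks i i<N []       = refl
  coeff-numerator-blocks i i<N (s ∷ ss) = begin
    coeff (numerator blocks (s ∷ ss)) i
      ≡⟨ coeff-⊕ (lam s · shift (as s) (blocks s)) (numerator blocks ss) i ⟩
    coeff (lam s · shift (as s) (blocks s)) i ℤ.+ coeff (numerator blocks ss) i
      ≡⟨ cong₂ ℤ._+_ (trans (coeff-· (lam s) (shift (as s) (blocks s)) i) (cong (lam s ℤ.*_) block)) (coeff-numerator-blocks i i<N ss) ⟩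
    lam s ℤ.* indicatorℤ (does (hit? (+ i) s)) ℤ.+ rest
      ≡⟨ select ⟩
    foldr ℤ._+_ (+ 0) (map lam (filter (hit? (+ i)) (s ∷ ss))) ∎
    where
    open ≡-Reasoning
    rest = foldr ℤ._+_ (+ 0) (map lam (filter (hit? (+ i)) ss))
    block : coeff (shift (as s) (blocks s)) i ≡ indicatorℤ (does (hit? (+ i) s))
    block = trans (coeff-shift-geometric (ns s) {{ns-nonZero s}} (N/n s) (as s) i (as<ns s) (subst (i <_) (ℕDiv._∣_.equality (ns∣N s)) i<N))
      (cong (λ t → indicatorℤ (does (ns s ∣? ∣ + i ℤ.- t ∣))) (sym (a≡+as s)))
    select : lam s ℤ.* indicatorℤ (does (hit? (+ i) s)) ℤ.+ rest ≡ foldr ℤ._+_ (+ 0) (map lam (filter (hit? (+ i)) (s ∷ ss)))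
    -- `filter` branches on this same Boolean, so both sides compute together.
    select with does (hit? (+ i) s)
    ... | true  = cong (ℤ._+ rest) (ℤₚ.*-identityʳ (lam s))
    ... | false = trans (cong (ℤ._+ rest) (ℤₚ.*-zeroʳ (lam s))) (ℤₚ.+-identityˡ rest)

  coeff-W : ∀ i → i < N → coeff W i ≡ w k lam a n (+ i)
  coeff-W i i<N = coeff-numerator-blocks i i<N (allFin k)

  w-periodic : ∀ x r q → x ≡ r ℤ.+ q ℤ.* + N → w k lam a n x ≡ w k lam a n r
  w-periodic x r q x≡ = cong (λ ss → foldr ℤ._+_ (+ 0) (map lam ss))
    (Listₚ.filter-≐ (hit? x) (hit? r) ((λ {s} → ⇒ s) , (λ {s} → ⇐ s)) (allFin k))
    where
    shuffle : ∀ r q N a → r ℤ.+ q ℤ.* N ℤ.- a ≡ (r ℤ.- a) ℤ.+ q ℤ.* N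
    shuffle = solve-∀
    x-a≡ : ∀ s → x ℤ.- a s ≡ (r ℤ.- a s) ℤ.+ q ℤ.* + N
    x-a≡ s = trans (cong (ℤ._- a s) x≡) (shuffle r q (+ N) (a s))
    n∣qN : ∀ s → + ns s ℤDiv.∣ q ℤ.* + N
    n∣qN s = ℤDiv.∣n⇒∣m*n q (ℤDiv.∣ᵤ⇒∣ (ns∣N s))
    ⇒ : ∀ s → ns s ∣ ∣ x ℤ.- a s ∣ → ns s ∣ ∣ r ℤ.- a s ∣
    ⇒ s d = ℤDiv.∣⇒∣ᵤ {i = r ℤ.- a s} (ℤDiv.∣m+n∣n⇒∣m {m = r ℤ.- a s} (subst (+ ns s ℤDiv.∣_) (x-a≡ s) (ℤDiv.∣ᵤ⇒∣ {i = x ℤ.- a s} d)) (n∣qN s))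
    ⇐ : ∀ s → ns s ∣ ∣ r ℤ.- a s ∣ → ns s ∣ ∣ x ℤ.- a s ∣
    ⇐ s d = ℤDiv.∣⇒∣ᵤ {i = x ℤ.- a s} (subst (+ ns s ℤDiv.∣_) (sym (x-a≡ s)) (ℤDiv.∣m∣n⇒∣m+n (ℤDiv.∣ᵤ⇒∣ {i = r ℤ.- a s} d) (n∣qN s)))

  Monic-zᴺ-1 : Monic N (zⁿ-1 N)
  Monic-zᴺ-1 = Monic-zⁿ-1 N

  w≡0⇒W≡0 : (∀ x → w k lam a n x ≡ + 0) → ∀ i → coeff W i ≡ + 0
  w≡0⇒W≡0 w≡0 i with ℕₚ.<-≤-connex i N
  ... | inj₁ i<N = trans (coeff-W i i<N) (w≡0 (+ i))
  ... | inj₂ N≤i = numerator-vanish {zⁿ-1 N} {blocks} {N} Monic-zᴺ-1 blocks-cofactors (allFin k) i N≤i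

  W≡0⇒w≡0 : (∀ i → coeff W i ≡ + 0) → ∀ x → w k lam a n x ≡ + 0
  W≡0⇒w≡0 W≡0 x = trans (w-periodic x (+ r) (x ℤDivMod./ℕ N) (ℤDivMod.a≡a%ℕn+[a/ℕn]*n x N))
    (trans (sym (coeff-W r (ℤDivMod.n%ℕd<d x N))) (W≡0 r))
    where r = x ℤDivMod.%ℕ N

  -- Transfer of the polynomial identities to the field.

  module InField {c ℓ} (F : CharZeroField c ℓ) where
    open CharZeroField F renaming (_×_ to _×ᶠ_; refl to ≈-refl; sym to ≈-sym; trans to ≈-trans)
    open FieldProperties F
    open Evaluation commutativeRing fromℤ-hom
    open import Algebra.Properties.Ring (CommutativeRing.ring commutativeRing) using (x∙y⁻¹≈ε⇒x≈y; -0#≈0#)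
    open import Relation.Binary.Reasoning.Setoid setoid

    -- Agreement at integers passes to the field through coefficients: those of `p ⊖ q` all vanish,
    -- even if the list is not empty.
    eval-≐ : ∀ p q → p ≐ q → ∀ x → eval p x ≈ eval q x
    eval-≐ p q p≐q x = x∙y⁻¹≈ε⇒x≈y _ _ (begin
      eval p x - eval q x                       ≈⟨ solve 2 (λ a b → a :+ :- b := a :+ con -[1+ 0 ] :* b) ≈-refl _ _ ⟩
      eval p x + fromℤ -[1+ 0 ] * eval q x      ≈⟨ +-congˡ (eval-· -[1+ 0 ] q x) ⟨
      eval p x + eval (-[1+ 0 ] · q) x          ≈⟨ eval-⊕ p (-[1+ 0 ] · q) x ⟨
      eval (p ⊖ q) x                            ≈⟨ eval-zero (p ⊖ q) x (≐⇒⊖-vanish p q p≐q) ⟩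
      0#                                        ∎)

    eval-zⁿ-1 : ∀ m x → eval (zⁿ-1 m) x ≈ x ^ m - 1#
    eval-zⁿ-1 m x = begin
      eval (zⁿ-1 m) x
        ≈⟨ eval-⊕ (shift m (+ 1 ∷ [])) _ x ⟩
      eval (shift m (+ 1 ∷ [])) x + eval (-[1+ 0 ] ∷ []) x
        ≈⟨ +-cong (≈-trans (eval-shift m (+ 1 ∷ []) x) (*-congˡ (≈-trans (eval-const (+ 1) x) 1-homo))) (≈-trans (eval-const -[1+ 0 ] x) (-‿cong 1-homo)) ⟩
      x ^ m * 1# - 1#
        ≈⟨ +-congʳ (*-identityʳ _) ⟩
      x ^ m - 1# ∎

    module _ (ζ : Carrier) (1-ζⁿ≉0 : ∀ s → ¬ (1# - ζ ^ ns s ≈ 0#)) where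

      term : Fin k → Carrier
      term s = fromℤ (lam s) * ((ζ ^ as s) / (1# - ζ ^ ns s))

      -- The minus sign arises because the cofactors belong to zⁿ - 1 while the sum has denominators
      -- 1 - zⁿ.
      numerator-eval : ∀ {D Q} → Cofactors D Q → ∀ ss → eval D ζ * Σ-list (map term ss) ≈ - eval (numerator Q ss) ζ
      numerator-eval {D} {Q} DQ []       = ≈-trans (zeroʳ _) (≈-sym -0#≈0#)
      numerator-eval {D} {Q} DQ (s ∷ ss) = begin
        eval D ζ * (l * (z * i) + Σ-list (map term ss))
          ≈⟨ distribˡ _ _ _ ⟩
        eval D ζ * (l * (z * i)) + eval D ζ * Σ-list (map term ss)
          ≈⟨ +-cong (*-congʳ D≈) (numerator-eval {D} {Q} DQ ss) ⟩
        (q * (X - 1#)) * (l * (z * i)) + - eval (numerator Q ss) ζ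
          -- The solver has constants only as images of integers, so 1 is first written as the image
          -- of + 1.
          ≈⟨ +-congʳ (*-congʳ (*-congˡ (+-congˡ (-‿cong 1-homo)))) ⟨
        (q * (X - fromℤ (+ 1))) * (l * (z * i)) + - eval (numerator Q ss) ζ
          ≈⟨ solve 6 (λ q X l z i t → (q :* (X :+ :- con (+ 1))) :* (l :* (z :* i)) :+ :- t := :- (((con (+ 1) :+ :- X) :* i) :* (l :* (z :* q)) :+ t)) ≈-refl
               q X l z i (eval (numerator Q ss) ζ) ⟩
        - (((fromℤ (+ 1) - X) * i) * (l * (z * q)) + eval (numerator Q ss) ζ)
          ≈⟨ -‿cong (+-congʳ (*-congʳ (≈-trans (*-congʳ (+-congʳ 1-homo)) (inverseʳ _ (1-ζⁿ≉0 s))))) ⟩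
        - (1# * (l * (z * q)) + eval (numerator Q ss) ζ)
          ≈⟨ -‿cong (+-congʳ (*-identityˡ _)) ⟩
        - (l * (z * q) + eval (numerator Q ss) ζ)
          ≈⟨ -‿cong (≈-trans (eval-⊕ (lam s · shift (as s) (Q s)) _ ζ) (+-congʳ (≈-trans (eval-· (lam s) (shift (as s) (Q s)) ζ) (*-congˡ (eval-shift (as s) (Q s) ζ))))) ⟨
        - eval (numerator Q (s ∷ ss)) ζ ∎
        where
        l = fromℤ (lam s)
        z = ζ ^ as s
        X = ζ ^ ns s
        i = (1# - X) ⁻¹
        q = eval (Q s) ζ
        D≈ : eval D ζ ≈ q * (X - 1#)
        D≈ = ≈-trans (eval-≐ D (Q s ⊗ zⁿ-1 (ns s)) (λ x → trans (DQ s x) (sym (at-⊗ (Q s) (zⁿ-1 (ns s)) x))) ζ)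
          (≈-trans (eval-⊗ (Q s) (zⁿ-1 (ns s)) ζ) (*-congˡ (eval-zⁿ-1 (ns s) ζ)))

open CharZeroField using (Carrier; _≈_; 0#; IsPrimitiveRoot; cycloSum)

-- The two implications.

module Equivalence {c ℓ} (F : CharZeroField c ℓ) {k} (lam a n : Fin k → ℤ)
  (0≤a : ∀ s → + 0 ℤ.≤ a s) (a<n : ∀ s → a s ℤ.< n s)
  (d′ : ℕ) (p-prime : Prime (2 ℕ.+ d′)) (cardS<p : cardS k n < 2 ℕ.+ d′)
  (ζ : Carrier F) (ζ-primitive : IsPrimitiveRoot F (2 ℕ.+ d′) ζ) where
  open CharZeroField F using (1#; -_; _-_; _*_; _^_; Σ-list; *-congˡ; -‿cong; zeroʳ; setoid; commutativeRing)
    renaming (0# to 0ᶠ; _≈_ to _≈ᶠ_; trans to ≈-trans; sym to ≈-sym)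
  open FieldProperties F
  open Evaluation commutativeRing fromℤ-hom
  open Numerators lam a n 0≤a a<n
  open InField F
  open Cyclotomic F d′ p-prime ζ ζ-primitive using (root⇒zero; ζ^≉1)
  open import Algebra.Properties.Ring (CommutativeRing.ring commutativeRing) using (x∙y⁻¹≈ε⇒x≈y; -0#≈0#; -‿involutive)

  open MonicLcm (monicLcm ns ns-nonZero) renaming (L to D)
  open IsLcm isLcm

  m : ℕ
  m = count (hits N ns) N

  D-monic : Monic m D
  D-monic = monic N ns∣N

  Q : Fin k → Poly
  Q s = _∣ₚ_.quotient (multiple s)

  Q-cofactors : Cofactors D Q
  Q-cofactors s = _∣ₚ_.equality (multiple s)

  m≤d : m ≤ 1 ℕ.+ d′
  m≤d = ℕₚ.≤-pred (ℕₚ.≤-<-trans (count-hits≤cardS k n ns-nonZero N) cardS<p)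

  -- z^(n s) - 1 divides `D`, so n s ≤ m < p. The bound on the number of fractions thereby also
  -- keeps every denominator 1 - ζ^(n s) away from 0.
  ns<p : ∀ s → ns s < 2 ℕ.+ d′
  ns<p s with e , n+e≡m , _ ← cofactor-monic {D} {Q} {m} D-monic Q-cofactors s =
    s≤s (ℕₚ.≤-trans (ℕₚ.m≤m+n (ns s) e) (ℕₚ.≤-trans (ℕₚ.≤-reflexive n+e≡m) m≤d))

  1-ζⁿ≉0 : ∀ s → ¬ (1# - ζ ^ ns s ≈ᶠ 0ᶠ)
  1-ζⁿ≉0 s eq = proj₂ ζ-primitive (ns s) (ℕₚ.≤-<-trans z≤n (as<ns s)) (ns<p s) (≈-sym (x∙y⁻¹≈ε⇒x≈y _ _ eq))

  ζᴺ-1≉0 : ¬ (eval (zⁿ-1 N) ζ ≈ᶠ 0ᶠ)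
  ζᴺ-1≉0 eq = ζ^≉1 N (p∤N p-prime (s≤s (s≤s z≤n)) ns<p) (x∙y⁻¹≈ε⇒x≈y _ _ (≈-trans (≈-sym (eval-zⁿ-1 N ζ)) eq))

  w≡0⇒sum≈0 : (∀ x → w k lam a n x ≡ + 0) → cycloSum F k lam a n ζ ≈ᶠ 0ᶠ
  w≡0⇒sum≈0 w≡0 = *-cancelˡ-0 ζᴺ-1≉0 (begin
    eval (zⁿ-1 N) ζ * cycloSum F k lam a n ζ   ≈⟨ numerator-eval ζ 1-ζⁿ≉0 {zⁿ-1 N} {blocks} blocks-cofactors (allFin k) ⟩
    - eval W ζ                                 ≈⟨ -‿cong (eval-zero W ζ (w≡0⇒W≡0 w≡0)) ⟩
    - 0ᶠ                                       ≈⟨ -0#≈0# ⟩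
    0ᶠ                                         ∎)
    where open import Relation.Binary.Reasoning.Setoid setoid

  -- By leastness `D` divides z^N - 1, which vanishes at no sample point; so `D` can be cancelled
  -- from D W = (z^N - 1) P = 0.
  D≢0 : ∀ x → D at x ≢ + 0
  D≢0 x D≡0 with dividesₚ r zᴺ-1≡rD ← least (zⁿ-1 N) (λ s → zⁿ-1-mono (ns∣N s)) =
    at-zⁿ-1≢0 N x (trans (zᴺ-1≡rD x) (trans (cong (r at x ℤ.*_) D≡0) (ℤₚ.*-zeroʳ (r at x))))

  sum≈0⇒w≡0 : cycloSum F k lam a n ζ ≈ᶠ 0ᶠ → ∀ x → w k lam a n x ≡ + 0
  sum≈0⇒w≡0 sum≈0 = W≡0⇒w≡0 (coeff-vanish W W-at≡0)
    where
    P : Poly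
    P = numerator Q (allFin k)
    Pζ≈0 : eval P ζ ≈ᶠ 0ᶠ
    Pζ≈0 = begin
      eval P ζ                                 ≈⟨ -‿involutive _ ⟨
      - - eval P ζ                             ≈⟨ -‿cong (numerator-eval ζ 1-ζⁿ≉0 {D} {Q} Q-cofactors (allFin k)) ⟨
      - (eval D ζ * cycloSum F k lam a n ζ)    ≈⟨ -‿cong (≈-trans (*-congˡ sum≈0) (zeroʳ _)) ⟩
      - 0ᶠ                                     ≈⟨ -0#≈0# ⟩
      0ᶠ                                       ∎
      where open import Relation.Binary.Reasoning.Setoid setoid
    P-at≡0 : ∀ x → P at x ≡ + 0
    P-at≡0 = root⇒zero P (λ i d≤i → numerator-vanish {D} {Q} {m} D-monic Q-cofactors (allFin k) i (ℕₚ.≤-trans m≤d d≤i)) Pζ≈0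
    W-at≡0 : ∀ x → W at x ≡ + 0
    W-at≡0 x = ℤₚ.*-cancelˡ-≡ (D at x) (W at x) (+ 0) {{ℤ.≢-nonZero (D≢0 x)}} (begin
      D at x ℤ.* W at x            ≡⟨ numerator-cross {D} {Q} {zⁿ-1 N} {blocks} Q-cofactors blocks-cofactors (allFin k) x ⟩
      (zⁿ-1 N) at x ℤ.* P at x     ≡⟨ cong ((zⁿ-1 N) at x ℤ.*_) (P-at≡0 x) ⟩
      (zⁿ-1 N) at x ℤ.* + 0        ≡⟨ ℤₚ.*-zeroʳ ((zⁿ-1 N) at x) ⟩
      + 0                          ≡⟨ ℤₚ.*-zeroʳ (D at x) ⟨
      D at x ℤ.* + 0               ∎)
      where open ≡-Reasoning

theorem1p2 : ∀ {c ℓ} (F : CharZeroField c ℓ) (k : ℕ) (lam a n : Fin k → ℤ) →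
    (∀ s → + 0 ℤ.≤ a s) → (∀ s → a s ℤ.< n s) →
    (p : ℕ) → Prime p → cardS k n < p →
    (ζ : Carrier F) → IsPrimitiveRoot F p ζ →
    ((∀ (x : ℤ) → w k lam a n x ≡ + 0) ⇔ (_≈_ F (cycloSum F k lam a n ζ) (0# F)))
theorem1p2 F k lam a n 0≤a a<n 0             p-prime = contradiction p-prime ¬prime[0]
theorem1p2 F k lam a n 0≤a a<n 1             p-prime = contradiction p-prime ¬prime[1]
theorem1p2 F k lam a n 0≤a a<n (suc (suc d′)) p-prime cardS<p ζ ζ-primitive = mk⇔ w≡0⇒sum≈0 sum≈0⇒w≡0
  where open Equivalence F lam a n 0≤a a<n d′ p-prime cardS<p ζ ζ-primitive
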